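{- For every $t \in \mathbb{N}$, prime-length cycles do not have the $\frac{1}{t}$-integral Erd\H{o}s-P\'osa property, even when restricted to planar graphs. That is, for every $t \in \mathbb{N}$ there is no function $f:\mathbb{N}\to\mathbb{N}$ such that for all $k \in \mathbb{N}$ and all planar graphs $G$, either $G$ contains a collection of $k$ cycles of prime length such that every vertex of $G$ lies in at most $t$ of these cycles, or there exists $X \subseteq V(G)$ with $|X| \leq f(k)$ such that $G - X$ has no cycle of prime length.
   Context: $\mathbb{N}$ denotes the set of positive integers. Graphs are finite. The length of a cycle is its number of edges. -}

module Defs where

open import Data.Nat using (ℕ; zero; suc; _+_; _*_; _≤_; _<_)
open import Data.Nat.Primality using (Prime)
open import Data.Bool using (Bool; true; false; T; not; _∧_)
open import Data.Fin using (Fin; zero; suc; toℕ)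
open import Data.Fin.Subset using (Subset; _∈_; ∣_∣)
open import Data.Fin.Properties using (any?)
open import Data.List using (List; length; filter; allFin; concatMap; map)
open import Data.Product using (Σ; ∃; ∃-syntax; _×_; _,_; proj₁; proj₂)
open import Relation.Nullary using (¬_; Dec; does)
open import Relation.Nullary.Decidable using (T?; ¬?)
open import Relation.Binary.PropositionalEquality using (_≡_; subst)
open import Function.Definitions using (Injective)

record Graph : Set where
  field
    n      : ℕ
    adj    : Fin n → Fin n → Bool
    sym    : ∀ u v → adj u v ≡ adj v u
    irrefl : ∀ v → adj v v ≡ false

module _ (G : Graph) where
  open Graph G

  Vertex : Set
  Vertex = Fin n

  edgeCount : ℕ
  edgeCount = length (filter (λ p → T? (adj (proj₁ p) (proj₂ p)))
                      (filter (λ p → toℕ (proj₁ p) Data.Nat.<? toℕ (proj₂ p))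
                        (concatMap (λ u → map (λ v → u , v) (allFin n)) (allFin n))))
    where import Data.Nat

  isolatedCount : ℕ
  isolatedCount = length (filter (λ v → ¬? (any? (λ w → T? (adj v w)))) (allFin n))

  data Reach : Vertex → Vertex → Set where
    here : ∀ {v} → Reach v v
    step : ∀ {u v w} → T (adj u v) → Reach v w → Reach u w

  ComponentCount : ℕ → Set
  ComponentCount c =
    Σ (Fin c → Vertex) λ rep →
      (∀ i j → Reach (rep i) (rep j) → i ≡ j) × (∀ v → ∃[ i ] Reach (rep i) v)

  Dart : Set
  Dart = Σ (Vertex × Vertex) λ p → T (adj (proj₁ p) (proj₂ p))

  tail : Dart → Vertex
  tail d = proj₁ (proj₁ d)

  rev : Dart → Dart
  rev ((u , v) , e) = (v , u) , subst T (sym u v) e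

  iter : ∀ {A : Set} → (A → A) → ℕ → A → A
  iter f zero    a = a
  iter f (suc k) a = f (iter f k a)

  record RotationSystem : Set where
    field
      rot      : Dart → Dart
      rot⁻¹    : Dart → Dart
      inv₁     : ∀ d → rot (rot⁻¹ d) ≡ d
      inv₂     : ∀ d → rot⁻¹ (rot d) ≡ d
      tail-rot : ∀ d → tail (rot d) ≡ tail d
      cyclic   : ∀ d d' → tail d ≡ tail d' → ∃[ j ] iter rot j d ≡ d'

    face : Dart → Dart
    face d = rot (rev d)

    SameFace : Dart → Dart → Set
    SameFace d d' = ∃[ j ] iter face j d ≡ d'

    FaceCount : ℕ → Set
    FaceCount f =
      Σ (Fin f → Dart) λ rep →
        (∀ i j → SameFace (rep i) (rep j) → i ≡ j) × (∀ d → ∃[ i ] SameFace (rep i) d)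

  -- G is planar: it has a rotation system of Euler genus 0 (sphere
  -- embedding), i.e. summing Euler's formula V - E + F = 2 over the
  -- components (an isolated vertex contributes one face):
  --   n + F + #isolated = 2 c + E.
  Planar : Set
  Planar = ∃[ R ] ∃[ f ] ∃[ c ]
             RotationSystem.FaceCount R f × ComponentCount c ×
             (n + f + isolatedCount ≡ 2 * c + edgeCount)

  cnext : ∀ {l} → Fin (suc l) → Fin (suc l)
  cnext {zero}  zero    = zero
  cnext {suc l} zero    = suc zero
  cnext {suc l} (suc i) with cnext {l} i
  ... | zero  = zero
  ... | suc j = suc (suc j)

  record Cycle : Set where
    field
      m     : ℕ
      vs    : Fin (3 + m) → Vertex
      inj   : Injective _≡_ _≡_ vs
      edges : ∀ i → T (adj (vs i) (vs (cnext i)))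

    len : ℕ
    len = 3 + m

  OnCycle : Vertex → Cycle → Set
  OnCycle v C = ∃[ i ] Cycle.vs C i ≡ v

  onCycle? : ∀ v C → Dec (OnCycle v C)
  onCycle? v C = any? (λ i → Cycle.vs C i Data.Fin.≟ v)
    where import Data.Fin

  PrimeCycle : Set
  PrimeCycle = Σ Cycle λ C → Prime (Cycle.len C)

  -- k prime cycles (a family, repetitions allowed) such that every vertex
  -- lies on at most t of them
  FractionalPacking : ℕ → ℕ → Set
  FractionalPacking t k =
    Σ (Fin k → PrimeCycle) λ Cs →
      ∀ v → length (filter (λ i → onCycle? v (proj₁ (Cs i))) (allFin k)) ≤ t

  HittingSet : Subset n → Set
  HittingSet X = ∀ (C : PrimeCycle) → ∃[ i ] (Cycle.vs (proj₁ C) i ∈ X)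

{-# OPTIONS --safe #-}
module Submission where

-- Take q = s + 1 concentric circles and 2 q ovals, each crossing every circle
-- twice, and replace the edges of this plane graph by paths.  The top arc of
-- every oval gets length γ, the edge closing circle y gets a length that is
-- congruent to P - q γ modulo M, and all other edges get length M.  If a cycle
-- runs through a closing edges and b top arcs, then its length is
-- a (P - q γ) + b γ modulo M, and the numbers are such that this forces the
-- length to be composite if b < q.  So every prime-length cycle takes half of
-- the top arcs, and a family of more than 4 t of them has t + 1 members
-- through a common vertex.  On the other hand, a set X of at most s vertices
-- misses some circle y and some q ovals; the cycle along circle y that climbs
-- over the top of these ovals has length P, which is prime.

open import Defs
open import Data.Bool using (Bool; true; false; not; T; if_then_else_)
open import Data.Bool.Properties using (not-involutive; T-irrelevant)
open import Data.Empty using (⊥)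
open import Data.Fin using (Fin; zero; suc; toℕ; fromℕ; inject₁)
import Data.Fin as Fin
open import Data.Fin.Induction using (<-weakInduction; >-weakInduction)
open import Data.Fin.Permutation using (Permutation; permutation)
open import Data.Fin.Properties
  using (any?; toℕ-injective; toℕ<n; toℕ-fromℕ; toℕ-inject₁; +↔⊎; *↔×; 2↔Bool)
import Data.Fin.Properties as Fin using (suc-injective)
open import Data.Fin.Relation.Unary.Top using (view; ‵fromℕ; ‵inject₁)
open import Data.Fin.Subset using (Subset; ∣_∣) renaming (_∈_ to _∈ˢ_)
open import Data.Fin.Subset.Properties using (_∈?_; drop-there)
open import Data.List
  using (List; []; _∷_; _++_; length; map; concat; concatMap; tabulate; lookup; filter; allFin; cartesianProduct)
open import Data.List.Membership.Propositional using (_∈_)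
open import Data.List.Membership.Propositional.Properties
  using (∈-filter⁺; ∈-filter⁻; ∈-map⁺; ∈-map⁻; ∈-++⁻; ∈-concat⁻′; ∈-cartesianProduct⁺; ∈-allFin; ∈-lookup; ∈-tabulate⁻)
open import Data.List.Membership.Propositional.Properties.WithK using (unique∧set⇒bag)
open import Data.List.Properties
  using (length-map; length-++; length-tabulate; filter-none; map-++; map-∘; map-tabulate; map-concatMap;
         concat-map; tabulate-cong)
open import Data.List.Relation.Binary.BagAndSetEquality using (∼bag⇒↭)
open import Data.List.Relation.Binary.Permutation.Propositional.Properties using (↭-length)
open import Data.List.Relation.Unary.All as All using (All; []; _∷_)
import Data.List.Relation.Unary.All.Properties as All
open import Data.List.Relation.Unary.AllPairs as AllPairs using ([]; _∷_)
import Data.List.Relation.Unary.AllPairs.Properties as AllPairs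
open import Data.List.Relation.Unary.Any using (here)
open import Data.List.Relation.Unary.Unique.Propositional using (Unique)
import Data.List.Relation.Unary.Unique.Propositional.Properties as Unique
open import Data.Nat
  using (ℕ; zero; suc; _+_; _*_; _∸_; _≤_; _<_; z≤n; s≤s; _<?_; _!; _%_; _/_; NonZero; >-nonZero⁻¹; n>1⇒nonTrivial)
open import Data.Nat.DivMod using (m≡m%n+[m/n]*n; m%n≤n)
open import Data.Nat.Divisibility
import Data.Nat.ListAction as List using (sum)
open import Data.Nat.Primality using (Prime; composite; composite⇒¬prime; ¬prime[1]; prime⇒nonZero)
open import Data.Nat.Primality.Factorisation using (factorise)
open import Data.Nat.Properties
open import Algebra.Properties.CommutativeMonoid.Sum Data.Nat.Properties.+-0-commutativeMonoid
  using (sum; sum-cong-≗; ∑-distrib-+; ∑-comm; sum-permute; sum-init-last)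
open import Data.Nat.Tactic.RingSolver using (solve-∀)
open import Data.Product using (Σ; ∃; ∃-syntax; _×_; _,_; proj₁; proj₂)
open import Data.Product.Function.Dependent.Propositional using () renaming (cong to Σ-cong)
open import Data.Product.Function.NonDependent.Propositional using (_×-↔_)
open import Data.Product.Properties using (,-injectiveˡ; ,-injectiveʳ)
open import Data.Sum using (_⊎_; inj₁; inj₂; [_,_]′)
open import Data.Sum.Function.Propositional using (_⊎-↔_)
open import Data.Sum.Properties using (inj₁-injective)
open import Data.Unit using (tt)
open import Data.Vec using ([]; _∷_)
open import Function using (_∘_; _↔_; Inverse; mk↔ₛ′; mk⇔)
open import Function.Properties.Inverse using (↔-refl; ↔-sym; ↔-trans)
open import Relation.Binary using (tri<; tri≈; tri>)
open import Relation.Binary.Construct.Closure.ReflexiveTransitive using (Star; ε; _◅_; _◅◅_; gmap; reverse)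
open import Relation.Binary.PropositionalEquality
  using (_≡_; _≢_; refl; sym; trans; cong; cong₂; subst; subst₂; module ≡-Reasoning)
open import Relation.Nullary using (¬_; Dec; yes; no; does; contradiction)
open import Relation.Nullary.Decidable
  using (map′; _⊎-dec_; _×-dec_; T?; ¬?; does-⇔; dec-true; dec-false)

-- The order of the quantifiers shapes the construction. The number of cycles is fixed before `f`
-- tells how many vertices may be deleted, so the bound on packings must not depend on s. Hence
-- every prime cycle has to use a constant fraction of the top arcs, however many there are; one
-- half is possible because 2 q ovals minus s spoilt ones still leave q.
--
-- A cycle can wander through circles and ovals in many ways, and these are never classified: only
-- the numbers a and b enter, through a linear identity between lengths. The term - q γ in a closing
-- edge is a debt that only top arcs can repay.
--
-- The lengths are fixed in the order M, P, γ. P has to be large compared with M, but its residues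
-- are not prescribed, so the infinitude of primes suffices; it is γ that is adapted to the residue
-- of P.
--
-- Planarity is checked on the map before subdivision, although that map has multiple edges (a top
-- arc is parallel to a chord). Subdividing makes the graph simple and changes neither the faces nor
-- the difference of vertices and edges.

Step : {A : Set} → (A → A) → A → A → Set
Step f x y = f x ≡ y

flip : {U : Set} → U × Bool → U × Bool
flip (u , b) = u , not b

flip-involutive : {U : Set} (d : U × Bool) → flip (flip d) ≡ d
flip-involutive (u , b) = cong (u ,_) (not-involutive b)

T-does⁻ : {A : Set} (a? : Dec A) → T (does a?) → A
T-does⁻ (yes a) _ = a

concatMap-pairs : {A B : Set} (xs : List A) (ys : List B) →
  concatMap (λ x → map (x ,_) ys) xs ≡ cartesianProduct xs ys
concatMap-pairs []       ys = refl
concatMap-pairs (x ∷ xs) ys = cong (map (x ,_) ys ++_) (concatMap-pairs xs ys)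

-- Connected plane multigraphs given by rotation systems

Linked : {V E : Set} (end : E × Bool → V) → V → V → Set
Linked end x y = ∃[ d ] (end d ≡ x × end (flip d) ≡ y)

-- A connected multigraph embedded in the sphere: the pairs (e , b) are its
-- darts, (e , b) starts at end (e , b), and ρ rotates the darts around their
-- starting vertices.
record PlaneMap : Set₁ where
  field
    {V E F}      : Set
    {v e f}      : ℕ
    V↔           : V ↔ Fin v
    E↔           : E ↔ Fin e
    F↔           : F ↔ Fin f
    end          : E × Bool → V
    ρ ρ⁻¹        : E × Bool → E × Bool
    ρ-ρ⁻¹        : ∀ d → ρ (ρ⁻¹ d) ≡ d
    ρ⁻¹-ρ        : ∀ d → ρ⁻¹ (ρ d) ≡ d
    end-ρ        : ∀ d → end (ρ d) ≡ end d
    ρ-cyclic     : ∀ d d' → end d ≡ end d' → Star (Step ρ) d d'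
    -- The elements of `F` label the orbits of `ρ ∘ flip`: the label is constant along a face walk,
    -- and every dart is reached from the representative of its label.
    faceOf       : E × Bool → F
    faceOf-ρ     : ∀ d → faceOf (ρ (flip d)) ≡ faceOf d
    rep          : F → E × Bool
    faceOf-rep   : ∀ c → faceOf (rep c) ≡ c
    rep-reaches  : ∀ d → Star (Step (ρ ∘ flip)) (rep (faceOf d)) d
    root         : V
    connected    : ∀ x → Star (Linked end) root x
    incident     : ∀ x → ∃[ d ] end d ≡ x
    euler        : v + f ≡ 2 + e

-- Stated for darts, this excludes loops along with multiple edges: the two darts of a loop would
-- have the same ends.
Simple : PlaneMap → Set
Simple P = ∀ d d' → end d ≡ end d' → end (flip d) ≡ end (flip d') → d ≡ d'
  where open PlaneMap P

-- The planar graph realised by a simple plane map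

module Realisation (P : PlaneMap) (simple : Simple P) where

  open PlaneMap P renaming (V to W; E to U; v to n; e to N; V↔ to W↔; E↔ to U↔; F to Face; F↔ to Face↔)
  open Inverse W↔ public using () renaming
    (to to code; from to decode; strictlyInverseˡ to code-decode; strictlyInverseʳ to decode-code)
  open Inverse U↔ using () renaming
    (to to codeᵁ; from to decodeᵁ; strictlyInverseˡ to codeᵁ-decode; strictlyInverseʳ to decodeᵁ-code)

  code-injective : ∀ {x y} → code x ≡ code y → x ≡ y
  code-injective {x} {y} eq = trans (sym (decode-code x)) (trans (cong decode eq) (decode-code y))

  loopless : ∀ d → end d ≢ end (flip d)
  loopless d@(u , b) eq with simple d (flip d) eq (trans (sym eq) (cong end {d} {flip (flip d)} (sym (flip-involutive d))))
  loopless (u , true)  eq | ()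
  loopless (u , false) eq | ()

  Joins : U × Bool → Fin n → Fin n → Set
  Joins d x y = code (end d) ≡ x × code (end (flip d)) ≡ y

  JoinsAt : Fin n → Fin n → Fin N → Set
  JoinsAt x y j = Joins (decodeᵁ j , true) x y ⊎ Joins (decodeᵁ j , false) x y

  joinsAt⁻ : ∀ {x y} → ∃[ j ] JoinsAt x y j → ∃[ d ] Joins d x y
  joinsAt⁻ (j , inj₁ p) = _ , p
  joinsAt⁻ (j , inj₂ p) = _ , p

  joinsAt⁺ : ∀ {x y} → ∃[ d ] Joins d x y → ∃[ j ] JoinsAt x y j
  joinsAt⁺ {x} {y} ((u , true)  , p) =
    codeᵁ u , inj₁ (subst (λ v → Joins (v , true) x y) (sym (decodeᵁ-code u)) p)
  joinsAt⁺ {x} {y} ((u , false) , p) =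
    codeᵁ u , inj₂ (subst (λ v → Joins (v , false) x y) (sym (decodeᵁ-code u)) p)

  abstract
    joined? : ∀ x y → Dec (∃[ d ] Joins d x y)
    joined? x y = map′ joinsAt⁻ joinsAt⁺ (any? λ j → joins? (decodeᵁ j , true) ⊎-dec joins? (decodeᵁ j , false))
      where
      joins? : ∀ d → Dec (Joins d x y)
      joins? d = (code (end d) Fin.≟ x) ×-dec (code (end (flip d)) Fin.≟ y)

  joined-sym : ∀ {x y} → ∃[ d ] Joins d x y → ∃[ d ] Joins d y x
  joined-sym (d , p , q) = flip d , q , trans (cong (code ∘ end) (flip-involutive d)) p

  graph : Graph
  graph .Graph.n          = n
  graph .Graph.adj x y    = does (joined? x y)
  graph .Graph.sym x y    = does-⇔ (mk⇔ joined-sym joined-sym) (joined? x y) (joined? y x)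
  graph .Graph.irrefl x   = dec-false (joined? x x)
    λ (d , p , q) → loopless d (code-injective (trans p (sym q)))

  open Graph graph using (adj)

  adj⁺ : ∀ {x y} → ∃[ d ] Joins d x y → T (adj x y)
  adj⁺ {x} {y} j = subst T (sym (dec-true (joined? x y) j)) tt

  adj⁻ : ∀ {x y} → T (adj x y) → ∃[ d ] Joins d x y
  adj⁻ {x} {y} = T-does⁻ (joined? x y)

  dart : U × Bool → Dart graph
  dart d = (code (end d) , code (end (flip d))) , adj⁺ (d , refl , refl)

  undart : Dart graph → U × Bool
  undart (_ , a) = proj₁ (adj⁻ a)

  Dart-≡ : ∀ {d d' : Dart graph} → proj₁ d ≡ proj₁ d' → d ≡ d'
  Dart-≡ {_ , a} {_ , a'} refl = cong (_ ,_) (T-irrelevant a a')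

  undart-dart : ∀ d → undart (dart d) ≡ d
  undart-dart d with adj⁻ (proj₂ (dart d))
  ... | d' , p , q = simple d' d (code-injective p) (code-injective q)

  dart-undart : ∀ d → dart (undart d) ≡ d
  dart-undart (_ , a) with adj⁻ a
  ... | d' , p , q = Dart-≡ (cong₂ _,_ p q)

  rev-dart : ∀ d → rev graph (dart d) ≡ dart (flip d)
  rev-dart d = Dart-≡ (cong (λ d' → code (end (flip d)) , code (end d')) (sym (flip-involutive d)))

  -- `edgeCount` lists an edge once, as the pair with increasing endpoints. The ascending darts
  -- match the edges of the map with these pairs.
  Ascending : U × Bool → Set
  Ascending d = toℕ (code (end d)) < toℕ (code (end (flip d)))

  abstract
    orientation : ∀ u → ∃[ b ] Ascending (u , b)
    orientation u with <-cmp (toℕ (code (end (u , true)))) (toℕ (code (end (u , false))))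
    ... | tri< lt _ _ = true , lt
    ... | tri≈ _ eq _ = contradiction (code-injective (toℕ-injective eq)) (loopless (u , true))
    ... | tri> _ _ gt = false , gt

  orient : U → U × Bool
  orient u = u , proj₁ (orientation u)

  ascending-unique : ∀ u b c → Ascending (u , b) → Ascending (u , c) → b ≡ c
  ascending-unique u true  true  _ _ = refl
  ascending-unique u false false _ _ = refl
  ascending-unique u true  false p q = contradiction q (<-asym p)
  ascending-unique u false true  p q = contradiction q (<-asym p)

  orient-unique : ∀ d → Ascending d → orient (proj₁ d) ≡ d
  orient-unique (u , b) p = cong (u ,_) (ascending-unique u _ _ (proj₂ (orientation u)) p)

  orientedPair : Fin N → Fin n × Fin n
  orientedPair j = proj₁ (dart (orient (decodeᵁ j)))

  orientedPair-injective : ∀ {i j} → orientedPair i ≡ orientedPair j → i ≡ j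
  orientedPair-injective {i} {j} eq = begin
    i                                          ≡⟨ codeᵁ-decode i ⟨
    codeᵁ (decodeᵁ i)                          ≡⟨ cong (codeᵁ ∘ proj₁) same ⟩
    codeᵁ (decodeᵁ j)                          ≡⟨ codeᵁ-decode j ⟩
    j                                          ∎
    where
    open ≡-Reasoning
    same = simple (orient (decodeᵁ i)) (orient (decodeᵁ j))
      (code-injective (,-injectiveˡ eq)) (code-injective (,-injectiveʳ eq))

  -- Two lists without repetitions that have the same members are permutations of each other, hence
  -- equally long.
  edgeCount≡ : edgeCount graph ≡ N
  edgeCount≡ = trans (↭-length (∼bag⇒↭ (unique∧set⇒bag uniqueL uniqueR (mk⇔ to from))))
    (trans (length-map orientedPair (allFin N)) (length-tabulate _))
    where
    A? = λ (p : Fin n × Fin n) → T? (adj (proj₁ p) (proj₂ p))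
    O? = λ (p : Fin n × Fin n) → toℕ (proj₁ p) <? toℕ (proj₂ p)
    pairs = concatMap (λ u → map (λ v → u , v) (allFin n)) (allFin n)
    pairs≡ = concatMap-pairs (allFin n) (allFin n)
    uniqueL : Unique (filter A? (filter O? pairs))
    uniqueL = Unique.filter⁺ A? (Unique.filter⁺ O?
      (subst Unique (sym pairs≡) (Unique.cartesianProduct⁺ (Unique.allFin⁺ n) (Unique.allFin⁺ n))))
    uniqueR : Unique (map orientedPair (allFin N))
    uniqueR = Unique.map⁺ orientedPair-injective (Unique.allFin⁺ N)
    to : ∀ {p} → p ∈ filter A? (filter O? pairs) → p ∈ map orientedPair (allFin N)
    to {p} p∈ with ∈-filter⁻ A? {xs = filter O? pairs} p∈
    ... | p∈' , a with ∈-filter⁻ O? {xs = pairs} p∈' | adj⁻ a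
    ...   | _ , lt | d , refl , refl = subst (_∈ map orientedPair (allFin N))
            (trans (cong (λ u → proj₁ (dart (orient u))) (decodeᵁ-code (proj₁ d)))
                   (cong (proj₁ ∘ dart) (orient-unique d lt)))
            (∈-map⁺ orientedPair (∈-allFin (codeᵁ (proj₁ d))))
    from : ∀ {p} → p ∈ map orientedPair (allFin N) → p ∈ filter A? (filter O? pairs)
    from p∈ with ∈-map⁻ orientedPair p∈
    ... | j , _ , refl = ∈-filter⁺ A?
            (∈-filter⁺ O? (subst (orientedPair j ∈_) (sym pairs≡) (∈-cartesianProduct⁺ (∈-allFin _) (∈-allFin _)))
              (proj₂ (orientation (decodeᵁ j))))
            (proj₂ (dart (orient (decodeᵁ j))))

  iter-suc : ∀ {A : Set} (g : A → A) j x → iter graph g j (g x) ≡ iter graph g (suc j) x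
  iter-suc g zero    x = refl
  iter-suc g (suc j) x = cong g (iter-suc g j x)

  iter-transport : ∀ (g : Dart graph → Dart graph) {h} → (∀ d → g (dart d) ≡ dart (h d)) →
    ∀ {d d'} → Star (Step h) d d' → ∃[ j ] iter graph g j (dart d) ≡ dart d'
  iter-transport g g≡h ε = 0 , refl
  iter-transport g g≡h {d} (refl ◅ p) with iter-transport g g≡h p
  ... | j , eq = suc j , trans (sym (iter-suc g j (dart d))) (trans (cong (iter graph g j) (g≡h d)) eq)

  rotate rotate⁻¹ : Dart graph → Dart graph
  rotate   = dart ∘ ρ ∘ undart
  rotate⁻¹ = dart ∘ ρ⁻¹ ∘ undart

  tail-undart : ∀ d → code (end (undart d)) ≡ tail graph d
  tail-undart d = cong (tail graph) (dart-undart d)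

  rotate-dart : ∀ d → rotate (dart d) ≡ dart (ρ d)
  rotate-dart d = cong (dart ∘ ρ) (undart-dart d)

  rotate-cyclic : ∀ d d' → tail graph d ≡ tail graph d' → ∃[ j ] iter graph rotate j d ≡ d'
  rotate-cyclic d d' eq = proj₁ path , (begin
    iter graph rotate (proj₁ path) d                  ≡⟨ cong (iter graph rotate (proj₁ path)) (dart-undart d) ⟨
    iter graph rotate (proj₁ path) (dart (undart d))  ≡⟨ proj₂ path ⟩
    dart (undart d')                                  ≡⟨ dart-undart d' ⟩
    d'                                                ∎)
    where
    open ≡-Reasoning
    path = iter-transport rotate rotate-dart (ρ-cyclic (undart d) (undart d')
      (code-injective (trans (tail-undart d) (trans eq (sym (tail-undart d'))))))

  rotationSystem : RotationSystem graph
  rotationSystem = record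
    { rot      = rotate
    ; rot⁻¹    = rotate⁻¹
    ; inv₁     = λ d → trans (cong (dart ∘ ρ) (undart-dart _)) (trans (cong dart (ρ-ρ⁻¹ _)) (dart-undart d))
    ; inv₂     = λ d → trans (cong (dart ∘ ρ⁻¹) (undart-dart _)) (trans (cong dart (ρ⁻¹-ρ _)) (dart-undart d))
    ; tail-rot = λ d → trans (cong code (end-ρ (undart d))) (tail-undart d)
    ; cyclic   = rotate-cyclic
    }

  open RotationSystem rotationSystem using (face; FaceCount)

  face-dart : ∀ d → face (dart d) ≡ dart (ρ (flip d))
  face-dart d = trans (cong rotate (rev-dart d)) (rotate-dart (flip d))

  faceOf-face : ∀ d → faceOf (undart (face d)) ≡ faceOf (undart d)
  faceOf-face d = begin
    faceOf (undart (face d))                  ≡⟨ cong (faceOf ∘ undart ∘ face) (dart-undart d) ⟨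
    faceOf (undart (face (dart (undart d))))  ≡⟨ cong (faceOf ∘ undart) (face-dart (undart d)) ⟩
    faceOf (undart (dart (ρ (flip (undart d)))))  ≡⟨ cong faceOf (undart-dart _) ⟩
    faceOf (ρ (flip (undart d)))              ≡⟨ faceOf-ρ (undart d) ⟩
    faceOf (undart d)                         ∎
    where open ≡-Reasoning

  faceOf-iter : ∀ j d → faceOf (undart (iter graph face j d)) ≡ faceOf (undart d)
  faceOf-iter zero    d = refl
  faceOf-iter (suc j) d = trans (faceOf-face _) (faceOf-iter j d)

  open Inverse Face↔ using () renaming
    (to to codeᶠ; from to decodeᶠ; strictlyInverseˡ to codeᶠ-decode; strictlyInverseʳ to decodeᶠ-code)

  faceDart : Fin f → Dart graph
  faceDart i = dart (rep (decodeᶠ i))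

  codeᶠ-faceDart : ∀ i → codeᶠ (faceOf (undart (faceDart i))) ≡ i
  codeᶠ-faceDart i = trans (cong (codeᶠ ∘ faceOf) (undart-dart _))
    (trans (cong codeᶠ (faceOf-rep _)) (codeᶠ-decode i))

  faceCount : FaceCount f
  faceCount = faceDart , distinct , covering
    where
    distinct : ∀ i j → ∃[ k ] iter graph face k (faceDart i) ≡ faceDart j → i ≡ j
    distinct i j (k , eq) = begin
      i                                                       ≡⟨ codeᶠ-faceDart i ⟨
      codeᶠ (faceOf (undart (faceDart i)))                    ≡⟨ cong codeᶠ (faceOf-iter k (faceDart i)) ⟨
      codeᶠ (faceOf (undart (iter graph face k (faceDart i)))) ≡⟨ cong (codeᶠ ∘ faceOf ∘ undart) eq ⟩
      codeᶠ (faceOf (undart (faceDart j)))                    ≡⟨ codeᶠ-faceDart j ⟩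
      j                                                       ∎
      where open ≡-Reasoning
    covering : ∀ d → ∃[ i ] ∃[ k ] iter graph face k (faceDart i) ≡ d
    covering d with iter-transport face face-dart (rep-reaches (undart d))
    ... | k , eq = codeᶠ (faceOf (undart d)) , k , trans
            (cong (λ c → iter graph face k (dart (rep c))) (decodeᶠ-code _))
            (trans eq (dart-undart d))

  reach : ∀ {x y} → Star (Linked end) x y → Reach graph (code x) (code y)
  reach ε = here
  reach ((d , refl , refl) ◅ p) = step (adj⁺ (d , refl , refl)) (reach p)

  componentCount : ComponentCount graph 1
  componentCount = (λ _ → code root) , (λ { zero zero _ → refl }) ,
    λ v → zero , subst (Reach graph (code root)) (code-decode v) (reach (connected (decode v)))

  isolatedCount≡0 : isolatedCount graph ≡ 0
  isolatedCount≡0 = cong length (filter-none (λ v → ¬? (any? (λ w → T? (adj v w))))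
    {xs = allFin n} (All.tabulate λ {v} _ isolated → isolated (neighbour v)))
    where
    neighbour : ∀ v → ∃[ w ] T (adj v w)
    neighbour v with incident (decode v)
    ... | d , eq = _ , adj⁺ (d , trans (cong code eq) (code-decode v) , refl)

  planar : Planar graph
  planar = rotationSystem , f , 1 , faceCount , componentCount ,
    -- With one component and no isolated vertex, the identity required by `Planar` is Euler's
    -- formula of the map.
    trans (cong (n + f +_) isolatedCount≡0) (trans (+-identityʳ _) (trans euler (cong (2 +_) (sym edgeCount≡))))

-- Subdivision

Σ-Fin↔ : ∀ {n} (g : Fin n → ℕ) → Σ (Fin n) (Fin ∘ g) ↔ Fin (sum g)
Σ-Fin↔ {zero}  g = mk↔ₛ′ (λ { (() , _) }) (λ ()) (λ ()) (λ { (() , _) })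
Σ-Fin↔ {suc n} g = ↔-trans split (↔-trans (↔-refl ⊎-↔ Σ-Fin↔ (g ∘ suc)) (↔-sym +↔⊎))
  where
  split : Σ (Fin (suc n)) (Fin ∘ g) ↔ (Fin (g zero) ⊎ Σ (Fin n) (Fin ∘ g ∘ suc))
  split = mk↔ₛ′ (λ { (zero , j) → inj₁ j ; (suc i , j) → inj₂ (i , j) })
    (λ { (inj₁ j) → zero , j ; (inj₂ (i , j)) → suc i , j })
    (λ { (inj₁ j) → refl ; (inj₂ _) → refl }) (λ { (zero , j) → refl ; (suc i , j) → refl })

-- For whatever is exceptional at the last index: the far end of a subdivided edge, the wrap-around
-- of a cyclic order, the top of an oval, the closing edge of a circle.
lastOr : {A : Set} {n : ℕ} → A → (Fin n → A) → Fin (suc n) → A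
lastOr {n = zero}  a f zero    = a
lastOr {n = suc n} a f zero    = f zero
lastOr {n = suc n} a f (suc i) = lastOr a (f ∘ suc) i

lastOr-fromℕ : {A : Set} {n : ℕ} (a : A) (f : Fin n → A) → lastOr a f (fromℕ n) ≡ a
lastOr-fromℕ {n = zero}  a f = refl
lastOr-fromℕ {n = suc n} a f = lastOr-fromℕ a (f ∘ suc)

lastOr-inject₁ : {A : Set} {n : ℕ} (a : A) (f : Fin n → A) (i : Fin n) → lastOr a f (inject₁ i) ≡ f i
lastOr-inject₁ a f zero    = refl
lastOr-inject₁ a f (suc i) = lastOr-inject₁ a (f ∘ suc) i

module Subdivision (P : PlaneMap) (ι′ : PlaneMap.E P → ℕ) where

  open PlaneMap P

  -- Edge x receives 2 + ι′ x new vertices.  With at least two of them on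
  -- every edge the subdivision is simple, whatever loops and multiple edges
  -- P has.
  ι : E → ℕ
  ι x = 2 + ι′ x

  ℓ : E → ℕ
  ℓ x = suc (ι x)

  Inner U W : Set
  Inner = Σ E λ x → Fin (ι x)
  U     = Σ E λ x → Fin (ℓ x)
  W     = V ⊎ Inner

  -- On the path that replaces x, number the vertices from 0 at `end (x , true)` to `ℓ x` at
  -- `end (x , false)`, so that inner vertex j gets number j + 1. Unit edge `(x , k)` joins the
  -- vertices k and k + 1.
  lo hi : U → W
  lo (x , zero)  = inj₁ (end (x , true))
  lo (x , suc j) = inj₂ (x , j)
  hi (x , k)     = lastOr (inj₁ (end (x , false))) (λ j → inj₂ (x , j)) k

  endˢ : U × Bool → W
  endˢ (u , true)  = lo u
  endˢ (u , false) = hi u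

  start : E × Bool → U × Bool
  start (x , true)  = (x , zero) , true
  start (x , false) = (x , fromℕ _) , false

  forth back : Inner → U × Bool
  forth (x , j) = (x , suc j) , true
  back  (x , j) = (x , inject₁ j) , false

  -- An inner vertex has degree two, so the rotation exchanges `forth` and `back` there. As this is
  -- an involution, the same recipe extends both `ρ` and `ρ⁻¹`.
  rotate : (E × Bool → E × Bool) → U × Bool → U × Bool
  rotate r ((x , k)     , false) = lastOr (start (r (x , false))) (λ j → forth (x , j)) k
  rotate r ((x , zero)  , true)  = start (r (x , true))
  rotate r ((x , suc j) , true)  = back (x , j)

  inner-injective : ∀ {p q} → _≡_ {A = W} (inj₂ p) (inj₂ q) → p ≡ q
  inner-injective refl = refl

  data DartView : U × Bool → Set where
    ‵start : ∀ d → DartView (start d)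
    ‵forth : ∀ p → DartView (forth p)
    ‵back  : ∀ p → DartView (back p)

  dartView : ∀ d → DartView d
  dartView ((x , zero)  , true)  = ‵start (x , true)
  dartView ((x , suc j) , true)  = ‵forth (x , j)
  dartView ((x , k)     , false) with view k
  ... | ‵fromℕ     = ‵start (x , false)
  ... | ‵inject₁ j = ‵back (x , j)

  end-start : ∀ d → endˢ (start d) ≡ inj₁ (end d)
  end-start (x , true)  = refl
  end-start (x , false) = lastOr-fromℕ {n = ι x} _ (λ j → inj₂ (x , j))

  end-back : ∀ p → endˢ (back p) ≡ inj₂ p
  end-back (x , j) = lastOr-inject₁ _ _ j

  rotate-start : ∀ r d → rotate r (start d) ≡ start (r d)
  rotate-start r (x , true)  = refl
  rotate-start r (x , false) = lastOr-fromℕ {n = ι x} _ (λ j → forth (x , j))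

  rotate-back : ∀ r p → rotate r (back p) ≡ forth p
  rotate-back r (x , j) = lastOr-inject₁ _ _ j

  rotate-inverse : ∀ r s → (∀ d → r (s d) ≡ d) → ∀ d → rotate r (rotate s d) ≡ d
  rotate-inverse r s rs d with dartView d
  ... | ‵start d' = trans (cong (rotate r) (rotate-start s d'))
                      (trans (rotate-start r _) (cong start (rs d')))
  ... | ‵forth p  = rotate-back r p
  ... | ‵back p   = cong (rotate r) (rotate-back s p)

  end-rotate : ∀ d → endˢ (rotate ρ d) ≡ endˢ d
  end-rotate d with dartView d
  ... | ‵start d' = trans (cong endˢ (rotate-start ρ d'))
                      (trans (end-start _) (trans (cong inj₁ (end-ρ d')) (sym (end-start d'))))
  ... | ‵forth p  = end-back p
  ... | ‵back p   = trans (cong endˢ (rotate-back ρ p)) (sym (end-back p))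

  start≢inner : ∀ d {p d'} → endˢ d' ≡ inj₂ p → endˢ (start d) ≢ endˢ d'
  start≢inner d eq eq' with trans (sym (end-start d)) (trans eq' eq)
  ... | ()

  rotate-cyclic : ∀ d d' → endˢ d ≡ endˢ d' → Star (Step (rotate ρ)) d d'
  rotate-cyclic d d' eq with dartView d | dartView d'
  ... | ‵start c | ‵start c' = gmap start
        (λ { {x} refl → rotate-start ρ x })
        (ρ-cyclic c c' (inj₁-injective (trans (sym (end-start c)) (trans eq (end-start c')))))
  ... | ‵start c | ‵forth p  = contradiction eq (start≢inner c {d' = forth p} refl)
  ... | ‵start c | ‵back p   = contradiction eq (start≢inner c {d' = back p} (end-back p))
  ... | ‵forth p | ‵start c  = contradiction (sym eq) (start≢inner c {d' = forth p} refl)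
  ... | ‵back p  | ‵start c  = contradiction (sym eq) (start≢inner c {d' = back p} (end-back p))
  ... | ‵forth p | ‵forth q with refl ← inner-injective {p} {q} eq = ε
  ... | ‵forth p | ‵back q  with refl ← inner-injective {p} {q} (trans eq (end-back q)) = refl ◅ ε
  ... | ‵back p  | ‵forth q with refl ← inner-injective {p} {q} (trans (sym (end-back p)) eq) = rotate-back ρ p ◅ ε
  ... | ‵back p  | ‵back q  with refl ← inner-injective {p} {q} (trans (sym (end-back p)) (trans eq (end-back q))) = ε

  faceOfˢ : U × Bool → F
  faceOfˢ ((x , _) , b) = faceOf (x , b)

  faceOf-start : ∀ d → faceOfˢ (start d) ≡ faceOf d
  faceOf-start (x , true)  = refl
  faceOf-start (x , false) = refl

  faceOf-rotate : ∀ d → faceOfˢ (rotate ρ (flip d)) ≡ faceOfˢ d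
  faceOf-rotate ((x , zero)  , false) = trans (faceOf-start (ρ (x , true))) (faceOf-ρ (x , false))
  faceOf-rotate ((x , suc j) , false) = refl
  faceOf-rotate ((x , k)     , true) with view k
  ... | ‵fromℕ     = trans (cong faceOfˢ (rotate-start ρ (x , false)))
                       (trans (faceOf-start (ρ (x , false))) (faceOf-ρ (x , true)))
  ... | ‵inject₁ j = cong faceOfˢ (rotate-back ρ (x , j))

  FaceStep : U × Bool → U × Bool → Set
  FaceStep = Step (rotate ρ ∘ flip)

  start-reaches : ∀ x b k → Star FaceStep (start (x , b)) ((x , k) , b)
  start-reaches x true = <-weakInduction (λ k → Star FaceStep (start (x , true)) ((x , k) , true)) ε
    λ j p → p ◅◅ (rotate-back ρ (x , j) ◅ ε)
  start-reaches x false = >-weakInduction (λ k → Star FaceStep (start (x , false)) ((x , k) , false)) ε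
    λ j p → p ◅◅ (refl ◅ ε)

  -- One step along a face of `P` becomes a run through all unit edges of the current edge, followed
  -- by a turn at its far end.
  start-step : ∀ d → Star FaceStep (start d) (start (ρ (flip d)))
  start-step (x , true)  = start-reaches x true (fromℕ _) ◅◅ (rotate-start ρ (x , false) ◅ ε)
  start-step (x , false) = start-reaches x false zero ◅◅ (refl ◅ ε)

  start-steps : ∀ {d d'} → Star (Step (ρ ∘ flip)) d d' → Star FaceStep (start d) (start d')
  start-steps ε = ε
  start-steps (refl ◅ p) = start-step _ ◅◅ start-steps p

  link-lo : ∀ x k → Star (Linked endˢ) (inj₁ (end (x , true))) (lo (x , k))
  link-lo x = <-weakInduction (λ k → Star (Linked endˢ) (inj₁ (end (x , true))) (lo (x , k))) ε
    λ j p → p ◅◅ ((((x , inject₁ j) , true) , refl , end-back (x , j)) ◅ ε)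

  linked-sym : ∀ {x y} → Linked endˢ x y → Linked endˢ y x
  linked-sym (d , p , q) = flip d , q , trans (cong endˢ (flip-involutive d)) p

  link-edge : ∀ x → Star (Linked endˢ) (inj₁ (end (x , true))) (inj₁ (end (x , false)))
  link-edge x = link-lo x (fromℕ _) ◅◅ ((((x , fromℕ _) , true) , refl , end-start (x , false)) ◅ ε)

  link-base : ∀ {x y} → Star (Linked end) x y → Star (Linked endˢ) (inj₁ x) (inj₁ y)
  link-base ε = ε
  link-base (((x , true)  , refl , refl) ◅ p) = link-edge x ◅◅ link-base p
  link-base (((x , false) , refl , refl) ◅ p) = reverse linked-sym (link-edge x) ◅◅ link-base p

  connectedˢ : ∀ w → Star (Linked endˢ) (inj₁ root) w
  connectedˢ (inj₁ x)       = link-base (connected x)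
  connectedˢ (inj₂ (x , j)) = link-base (connected _) ◅◅ link-lo x (suc j)

  incidentˢ : ∀ w → ∃[ d ] endˢ d ≡ w
  incidentˢ (inj₁ x) with incident x
  ... | d , refl = start d , end-start d
  incidentˢ (inj₂ p) = forth p , refl

  open Inverse E↔ using () renaming (from to decodeᴱ)

  I : ℕ
  I = sum (ι ∘ decodeᴱ)

  Inner↔ : Inner ↔ Fin I
  Inner↔ = ↔-sym (↔-trans (↔-sym (Σ-Fin↔ (ι ∘ decodeᴱ))) (Σ-cong (↔-sym E↔) ↔-refl))

  U↔E⊎Inner : U ↔ (E ⊎ Inner)
  U↔E⊎Inner = mk↔ₛ′ (λ { (x , zero) → inj₁ x ; (x , suc j) → inj₂ (x , j) })
    (λ { (inj₁ x) → x , zero ; (inj₂ (x , j)) → x , suc j })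
    (λ { (inj₁ x) → refl ; (inj₂ _) → refl }) (λ { (x , zero) → refl ; (x , suc j) → refl })

  subdivide : PlaneMap
  subdivide = record
    { V↔ = ↔-trans (V↔ ⊎-↔ Inner↔) (↔-sym +↔⊎)
    ; E↔ = ↔-trans U↔E⊎Inner (↔-trans (E↔ ⊎-↔ Inner↔) (↔-sym +↔⊎))
    ; F↔ = F↔
    ; end = endˢ
    ; ρ = rotate ρ
    ; ρ⁻¹ = rotate ρ⁻¹
    ; ρ-ρ⁻¹ = rotate-inverse ρ ρ⁻¹ ρ-ρ⁻¹
    ; ρ⁻¹-ρ = rotate-inverse ρ⁻¹ ρ ρ⁻¹-ρ
    ; end-ρ = end-rotate
    ; ρ-cyclic = rotate-cyclic
    ; faceOf = faceOfˢ
    ; faceOf-ρ = faceOf-rotate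
    ; rep = start ∘ rep
    ; faceOf-rep = λ c → trans (faceOf-start (rep c)) (faceOf-rep c)
    ; rep-reaches = λ { ((x , k) , b) → start-steps (rep-reaches (x , b)) ◅◅ start-reaches x b k }
    ; root = inj₁ root
    ; connected = connectedˢ
    ; incident = incidentˢ
    ; euler = trans (swap v I f) (cong (_+ I) euler)
    }
    where
    swap : ∀ a b c → a + b + c ≡ a + c + b
    swap = solve-∀

  same-direction : ∀ u u' → lo u ≡ lo u' → hi u ≡ hi u' → u ≡ u'
  same-direction (x , suc j) (x' , suc j') refl _ = refl
  same-direction (x , zero)  (x' , zero)   _ refl = refl

  height : W → ℕ
  height (inj₁ _)       = 0
  height (inj₂ (_ , j)) = toℕ j

  -- If `lo u ≡ hi u'` is an inner vertex, then u' directly precedes u on the same path, and `hi u`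
  -- is two steps ahead of `lo u'`; with three or more unit edges these cannot both be base
  -- vertices. If it is a base vertex, then `hi u` is the first and `lo u'` the last inner vertex of
  -- a path. With a single inner vertex, the two halves of a loop would violate the claim.
  opposite-directions : ∀ u u' → lo u ≡ hi u' → hi u ≢ lo u'
  opposite-directions (x , suc j) (x' , k) p q with view k
  ... | ‵fromℕ with trans p (end-start (x' , false))
  ...   | ()
  opposite-directions (x , suc j) (x' , k) p q | ‵inject₁ j' with trans p (end-back (x' , j'))
  opposite-directions (x , suc zero) (x , _) p () | ‵inject₁ zero | refl
  opposite-directions (x , suc (suc i)) (x , _) p q | ‵inject₁ (suc i) | refl with view i
  ... | ‵fromℕ with trans (sym (end-start (x , false))) q
  ...   | ()
  opposite-directions (x , suc (suc i)) (x , _) p q | ‵inject₁ (suc i) | refl | ‵inject₁ l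
    with trans (sym (end-back (x , suc (suc l)))) q
  ... | eq = contradiction
        (sym (trans (cong height eq) (trans (toℕ-inject₁ (inject₁ l)) (toℕ-inject₁ l)))) (m≢1+n+m (toℕ l))
  opposite-directions (x , zero) (x' , k) p q with view k
  ... | ‵inject₁ j' with trans p (end-back (x' , j'))
  ...   | ()
  opposite-directions (x , zero) (x' , _) p () | ‵fromℕ

  simple : Simple subdivide
  simple (u , true)  (u' , true)  p q = cong (_, true) (same-direction u u' p q)
  simple (u , false) (u' , false) p q = cong (_, false) (same-direction u u' q p)
  simple (u , true)  (u' , false) p q = contradiction q (opposite-directions u u' p)
  simple (u , false) (u' , true)  p q = contradiction p (opposite-directions u u' q)

-- Concentric circles crossed by ovals

next prev : ∀ {n} → Fin (suc n) → Fin (suc n)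
next         = lastOr zero suc
prev zero    = fromℕ _
prev (suc i) = inject₁ i

next-prev : ∀ {n} (i : Fin (suc n)) → next (prev i) ≡ i
next-prev zero    = lastOr-fromℕ zero suc
next-prev (suc i) = lastOr-inject₁ zero suc i

prev-next : ∀ {n} (i : Fin (suc n)) → prev (next i) ≡ i
prev-next i with view i
... | ‵fromℕ     = cong prev (lastOr-fromℕ zero suc)
... | ‵inject₁ j = cong prev (lastOr-inject₁ zero suc j)

-- suc m′ ovals, each crossing all of suc k concentric circles twice.  Oval i
-- crosses circle y in (i , L y) and (i , R y); it passes L 0 , … , L k ,
-- R k , … , R 0 in this order.  Circle y passes (0 , L y) , (0 , R y) ,
-- (1 , L y) , (1 , R y) , … in this order.
module Ovals (m′ k : ℕ) where

  m h : ℕ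
  m = suc m′
  h = suc k

  Side V E : Set
  Side = Fin h ⊎ Fin h
  V    = Fin m × Side
  E    = (Fin m × Side) ⊎ ((Fin m × Fin h) ⊎ (Fin m × Fin h))

  pattern L y = inj₁ y
  pattern R y = inj₂ y

  -- arc i s goes from (i , s) to the next crossing on oval i, chord i y from
  -- (i , L y) to (i , R y) and gap i y from (i , R y) to the next oval.
  pattern arc i s   = inj₁ (i , s)
  pattern chord i y = inj₂ (inj₁ (i , y))
  pattern gap i y   = inj₂ (inj₂ (i , y))

  succ pred : Side → Side
  succ (L y)       = lastOr (R (fromℕ k)) (λ j → L (suc j)) y
  succ (R zero)    = L zero
  succ (R (suc j)) = R (inject₁ j)
  pred (R y)       = lastOr (L (fromℕ k)) (λ j → R (suc j)) y
  pred (L zero)    = R zero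
  pred (L (suc j)) = L (inject₁ j)

  succ-top : succ (L (fromℕ k)) ≡ R (fromℕ k)
  succ-top = lastOr-fromℕ (R (fromℕ k)) (λ j → L (suc j))

  succ-L : ∀ j → succ (L (inject₁ j)) ≡ L (suc j)
  succ-L = lastOr-inject₁ (R (fromℕ k)) (λ j → L (suc j))

  pred-top : pred (R (fromℕ k)) ≡ L (fromℕ k)
  pred-top = lastOr-fromℕ (L (fromℕ k)) (λ j → R (suc j))

  pred-R : ∀ j → pred (R (inject₁ j)) ≡ R (suc j)
  pred-R = lastOr-inject₁ (L (fromℕ k)) (λ j → R (suc j))

  succ-pred : ∀ s → succ (pred s) ≡ s
  succ-pred (L zero)    = refl
  succ-pred (L (suc j)) = succ-L j
  succ-pred (R y) with view y
  ... | ‵fromℕ     = trans (cong succ pred-top) succ-top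
  ... | ‵inject₁ j = cong succ (pred-R j)

  pred-succ : ∀ s → pred (succ s) ≡ s
  pred-succ (R zero)    = refl
  pred-succ (R (suc j)) = pred-R j
  pred-succ (L y) with view y
  ... | ‵fromℕ     = trans (cong pred succ-top) pred-top
  ... | ‵inject₁ j = cong pred (succ-L j)

  -- The directions in which the darts leave a vertex, in counterclockwise
  -- order: into the oval, along it, out of it, back along it.
  data Direction : Set where
    inward along outward backward : Direction

  turn turn⁻¹ : Direction → Direction
  turn inward     = along
  turn along      = outward
  turn outward    = backward
  turn backward   = inward
  turn⁻¹ along    = inward
  turn⁻¹ outward  = along
  turn⁻¹ backward = outward
  turn⁻¹ inward   = backward

  turn-turn⁻¹ : ∀ c → turn (turn⁻¹ c) ≡ c
  turn-turn⁻¹ inward   = refl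
  turn-turn⁻¹ along    = refl
  turn-turn⁻¹ outward  = refl
  turn-turn⁻¹ backward = refl

  turn⁻¹-turn : ∀ c → turn⁻¹ (turn c) ≡ c
  turn⁻¹-turn inward   = refl
  turn⁻¹-turn along    = refl
  turn⁻¹-turn outward  = refl
  turn⁻¹-turn backward = refl

  turns : ∀ c c' → Star (Step turn) c c'
  turns c c' = to c ◅◅ from c'
    where
    to : ∀ c → Star (Step turn) c inward
    to inward   = ε
    to backward = refl ◅ ε
    to outward  = refl ◅ refl ◅ ε
    to along    = refl ◅ refl ◅ refl ◅ ε
    from : ∀ c → Star (Step turn) inward c
    from inward   = ε
    from along    = refl ◅ ε
    from outward  = refl ◅ refl ◅ ε
    from backward = refl ◅ refl ◅ refl ◅ ε

  end : E × Bool → V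
  end (arc i s   , true)  = i , s
  end (arc i s   , false) = i , succ s
  end (chord i y , true)  = i , L y
  end (chord i y , false) = i , R y
  end (gap i y   , true)  = i , R y
  end (gap i y   , false) = next i , L y

  direction : E × Bool → Direction
  direction (arc i s   , true)  = along
  direction (arc i s   , false) = backward
  direction (chord i y , _)     = inward
  direction (gap i y   , _)     = outward

  -- Every vertex has exactly one dart in each direction, so darts amount to pairs of a vertex and a
  -- direction, and the rotation acts on the direction alone. One cyclic order serves both sides of
  -- an oval because a traveller along the oval always has its interior on the same hand.
  dart : V → Direction → E × Bool
  dart (i , L y) inward   = chord i y , true
  dart (i , R y) inward   = chord i y , false
  dart (i , L y) outward  = gap (prev i) y , false
  dart (i , R y) outward  = gap i y , true
  dart (i , s)   along    = arc i s , true
  dart (i , s)   backward = arc i (pred s) , false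

  dart-along : ∀ v → dart v along ≡ (inj₁ v , true)
  dart-along (i , L y) = refl
  dart-along (i , R y) = refl

  dart-backward : ∀ i s → dart (i , s) backward ≡ (arc i (pred s) , false)
  dart-backward i (L y) = refl
  dart-backward i (R y) = refl

  dart-end : ∀ d → dart (end d) (direction d) ≡ d
  dart-end (arc i s   , true)  = dart-along (i , s)
  dart-end (arc i s   , false) = trans (dart-backward i (succ s)) (cong (λ s' → arc i s' , false) (pred-succ s))
  dart-end (chord i y , true)  = refl
  dart-end (chord i y , false) = refl
  dart-end (gap i y   , true)  = refl
  dart-end (gap i y   , false) = cong (λ i' → gap i' y , false) (prev-next i)

  end-dart : ∀ v c → end (dart v c) ≡ v
  end-dart (i , L y) inward   = refl
  end-dart (i , R y) inward   = refl
  end-dart (i , L y) outward  = cong (_, L y) (next-prev i)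
  end-dart (i , R y) outward  = refl
  end-dart (i , L y) along    = refl
  end-dart (i , R y) along    = refl
  end-dart (i , s)   backward = trans (cong end (dart-backward i s)) (cong (i ,_) (succ-pred s))

  direction-dart : ∀ v c → direction (dart v c) ≡ c
  direction-dart (i , L y) inward   = refl
  direction-dart (i , R y) inward   = refl
  direction-dart (i , L y) outward  = refl
  direction-dart (i , R y) outward  = refl
  direction-dart v         along    = cong direction (dart-along v)
  direction-dart (i , s)   backward = cong direction (dart-backward i s)

  rotate : (Direction → Direction) → E × Bool → E × Bool
  rotate t d = dart (end d) (t (direction d))

  rotate-dart : ∀ t v c → rotate t (dart v c) ≡ dart v (t c)
  rotate-dart t v c = cong₂ (λ w c' → dart w (t c')) (end-dart v c) (direction-dart v c)

  rotate-inverse : ∀ t t' → (∀ c → t (t' c) ≡ c) → ∀ d → rotate t (rotate t' d) ≡ d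
  rotate-inverse t t' tt' d = trans (rotate-dart t (end d) _) (trans (cong (dart (end d)) (tt' _)) (dart-end d))

  ρ : E × Bool → E × Bool
  ρ = rotate turn

  ρ-cyclic : ∀ d d' → end d ≡ end d' → Star (Step ρ) d d'
  ρ-cyclic d d' eq = subst (Star (Step ρ) d) (trans (cong (λ v → dart v (direction d')) eq) (dart-end d'))
    (subst (λ c → Star (Step ρ) c (dart (end d) (direction d'))) (dart-end d)
      (gmap (dart (end d)) (λ { {c} refl → rotate-dart turn (end d) c }) (turns (direction d) (direction d'))))

  Face : Set
  Face = (Fin m × Fin (suc h)) ⊎ ((Fin m × Fin k) ⊎ Bool)

  -- An oval is cut by the circles into the faces inside i l, bounded by
  -- circles l - 1 and l.  Between oval i and the next one there are the faces
  -- cell i l, bounded by circles l and l + 1.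
  pattern inside i l = inj₁ (i , l)
  pattern cell i l   = inj₂ (inj₁ (i , l))
  pattern south      = inj₂ (inj₂ false)
  pattern north      = inj₂ (inj₂ true)

  -- The counterpart of `inside` for the strip between oval i and the next one. Below circle 0 and
  -- beyond circle k nothing separates the strips, so there the face does not depend on i.
  outside : Fin m → Fin (suc h) → Face
  outside i zero    = south
  outside i (suc y) = lastOr north (λ j → cell i j) y

  outside-north : ∀ i → outside i (suc (fromℕ k)) ≡ north
  outside-north i = lastOr-fromℕ north (λ j → cell i j)

  outside-cell : ∀ i j → outside i (suc (inject₁ j)) ≡ cell i j
  outside-cell i = lastOr-inject₁ north (λ j → cell i j)

  faceOf : E × Bool → Face
  faceOf (arc i (L y) , true)  = inside i (suc y)
  faceOf (arc i (R y) , true)  = inside i (inject₁ y)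
  faceOf (arc i (L y) , false) = outside (prev i) (suc y)
  faceOf (arc i (R y) , false) = outside i (inject₁ y)
  faceOf (chord i y   , true)  = inside i (inject₁ y)
  faceOf (chord i y   , false) = inside i (suc y)
  faceOf (gap i y     , true)  = outside i (inject₁ y)
  faceOf (gap i y     , false) = outside i (suc y)

  φ : E × Bool → E × Bool
  φ = ρ ∘ flip

  φ-arc-top : ∀ i → φ (arc i (L (fromℕ k)) , true) ≡ (chord i (fromℕ k) , false)
  φ-arc-top i = cong (λ s → dart (i , s) inward) succ-top

  φ-arc-L : ∀ i j → φ (arc i (L (inject₁ j)) , true) ≡ (chord i (suc j) , true)
  φ-arc-L i j = cong (λ s → dart (i , s) inward) (succ-L j)

  φ-gap-top : ∀ i → φ (gap i (fromℕ k) , false) ≡ (arc i (L (fromℕ k)) , false)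
  φ-gap-top i = cong (λ s → arc i s , false) pred-top

  φ-gap-R : ∀ i j → φ (gap i (inject₁ j) , false) ≡ (arc i (R (suc j)) , false)
  φ-gap-R i j = cong (λ s → arc i s , false) (pred-R j)

  faceOf-φ : ∀ d → faceOf (φ d) ≡ faceOf d
  faceOf-φ (arc i (L y) , true) with view y
  ... | ‵fromℕ     = cong faceOf (φ-arc-top i)
  ... | ‵inject₁ j = cong faceOf (φ-arc-L i j)
  faceOf-φ (arc i (R zero)    , true)  = refl
  faceOf-φ (arc i (R (suc j)) , true)  = refl
  faceOf-φ (arc i (L y)       , false) = refl
  faceOf-φ (arc i (R y)       , false) = refl
  faceOf-φ (chord i y         , true)  = refl
  faceOf-φ (chord i y         , false) = refl
  faceOf-φ (gap i zero        , true)  = refl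
  faceOf-φ (gap i (suc j)     , true)  = cong (λ i' → outside i' (suc (inject₁ j))) (prev-next i)
  faceOf-φ (gap i y           , false) with view y
  ... | ‵fromℕ     = trans (cong faceOf (φ-gap-top i)) (trans (outside-north (prev i)) (sym (outside-north i)))
  ... | ‵inject₁ j = cong faceOf (φ-gap-R i j)

  rep : Face → E × Bool
  rep (inside i zero)    = arc i (R zero) , true
  rep (inside i (suc y)) = arc i (L y) , true
  rep (cell i j)         = gap i (suc j) , true
  rep south              = gap zero zero , true
  rep north              = gap zero (fromℕ k) , false

  faceOf-rep : ∀ c → faceOf (rep c) ≡ c
  faceOf-rep (inside i zero)    = refl
  faceOf-rep (inside i (suc y)) = refl
  faceOf-rep (cell i j)         = outside-cell i j
  faceOf-rep south              = refl
  faceOf-rep north              = outside-north zero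

  -- The boundaries of `south` and `north` alternate gaps with bottom arcs and top arcs
  -- respectively. The face walk meets the ovals in increasing order on one and in decreasing order
  -- on the other, hence the two opposite inductions.
  south-gaps : ∀ i → Star (Step φ) (gap zero zero , true) (gap i zero , true)
  south-gaps = <-weakInduction (λ i → Star (Step φ) (gap zero zero , true) (gap i zero , true)) ε
    λ j p → p ◅◅ (refl ◅ cong (λ i → gap i zero , true) (lastOr-inject₁ zero suc j) ◅ ε)

  north-gaps : ∀ i → Star (Step φ) (gap zero (fromℕ k) , false) (gap i (fromℕ k) , false)
  north-gaps = >-weakInduction (λ i → Star (Step φ) (gap zero (fromℕ k) , false) (gap i (fromℕ k) , false))
    (around zero) λ j p → p ◅◅ around (suc j)
    where
    around : ∀ i → Star (Step φ) (gap i (fromℕ k) , false) (gap (prev i) (fromℕ k) , false)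
    around i = φ-gap-top i ◅ refl ◅ ε

  φ-cell : ∀ i j → φ (arc (next i) (L (inject₁ j)) , false) ≡ (gap i (inject₁ j) , false)
  φ-cell i j = cong (λ i' → gap i' (inject₁ j) , false) (prev-next i)

  rep-reaches : ∀ d → Star (Step φ) (rep (faceOf d)) d
  rep-reaches (arc i (L y)       , true)  = ε
  rep-reaches (arc i (R zero)    , true)  = ε
  rep-reaches (arc i (R (suc j)) , true)  = φ-arc-L i j ◅ refl ◅ ε
  rep-reaches (chord i zero      , true)  = refl ◅ ε
  rep-reaches (chord i (suc j)   , true)  = φ-arc-L i j ◅ ε
  rep-reaches (chord i y         , false) with view y
  ... | ‵fromℕ     = φ-arc-top i ◅ ε
  ... | ‵inject₁ j = φ-arc-L i j ◅ refl ◅ refl ◅ ε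
  rep-reaches (arc i (L y)       , false) with view y
  ... | ‵fromℕ     rewrite outside-north (prev i) = north-gaps i ◅◅ (φ-gap-top i ◅ ε)
  ... | ‵inject₁ j rewrite outside-cell (prev i) j =
          cong (λ i' → arc i' (L (inject₁ j)) , false) (next-prev i) ◅ ε
  rep-reaches (arc i (R zero)    , false) =
    south-gaps (prev i) ◅◅ (cong (λ i' → arc i' (R zero) , false) (next-prev i) ◅ ε)
  rep-reaches (arc i (R (suc j)) , false) rewrite outside-cell i j =
    refl ◅ φ-cell i j ◅ φ-gap-R i j ◅ ε
  rep-reaches (gap i zero        , true)  = south-gaps i
  rep-reaches (gap i (suc j)     , true)  rewrite outside-cell i j = ε
  rep-reaches (gap i y           , false) with view y
  ... | ‵fromℕ     rewrite outside-north i = north-gaps i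
  ... | ‵inject₁ j rewrite outside-cell i j = refl ◅ φ-cell i j ◅ ε

  across : ∀ x → Star (Linked end) (end (x , true)) (end (x , false))
  across x = ((x , true) , refl , refl) ◅ ε

  connected : ∀ v → Star (Linked end) (zero , L zero) v
  connected (i , R y) = connected (i , L y) ◅◅ across (chord i y)
  connected (i , L y) = <-weakInduction (λ i → Star (Linked end) (zero , L zero) (i , L zero)) ε
      (λ j p → p ◅◅ across (chord (inject₁ j) zero) ◅◅
        subst (λ i' → Star (Linked end) (inject₁ j , R zero) (i' , L zero)) (lastOr-inject₁ zero suc j)
          (across (gap (inject₁ j) zero))) i
    ◅◅ <-weakInduction (λ y → Star (Linked end) (i , L zero) (i , L y)) ε
      (λ j p → p ◅◅ subst (λ s → Star (Linked end) (i , L (inject₁ j)) (i , s)) (succ-L j)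
        (across (arc i (L (inject₁ j))))) y

  V↔ : V ↔ Fin (m * (h + h))
  V↔ = ↔-trans (↔-refl ×-↔ ↔-sym +↔⊎) (↔-sym *↔×)

  ovals : PlaneMap
  ovals = record
    { V↔ = V↔
    ; E↔ = ↔-trans (V↔ ⊎-↔ ↔-trans (↔-sym *↔× ⊎-↔ ↔-sym *↔×) (↔-sym +↔⊎)) (↔-sym +↔⊎)
    ; F↔ = ↔-trans (↔-sym *↔× ⊎-↔ ↔-trans (↔-sym *↔× ⊎-↔ ↔-sym 2↔Bool) (↔-sym +↔⊎)) (↔-sym +↔⊎)
    ; end = end
    ; ρ = ρ
    ; ρ⁻¹ = rotate turn⁻¹
    ; ρ-ρ⁻¹ = rotate-inverse turn turn⁻¹ turn-turn⁻¹
    ; ρ⁻¹-ρ = rotate-inverse turn⁻¹ turn turn⁻¹-turn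
    ; end-ρ = λ d → end-dart (end d) _
    ; ρ-cyclic = ρ-cyclic
    ; faceOf = faceOf
    ; faceOf-ρ = faceOf-φ
    ; rep = rep
    ; faceOf-rep = faceOf-rep
    ; rep-reaches = rep-reaches
    ; root = zero , L zero
    ; connected = connected
    ; incident = λ v → dart v along , end-dart v along
    ; euler = count m′ k
    }
    where
    count : ∀ a b → suc a * (suc b + suc b) + (suc a * suc (suc b) + (suc a * b + 2))
                  ≡ 2 + (suc a * (suc b + suc b) + (suc a * suc b + suc a * suc b))
    count = solve-∀

-- Lengths of cycles in a subdivision

cnext≡next : ∀ G {l} (i : Fin (suc l)) → cnext G i ≡ next i
cnext≡next G {zero}  zero    = refl
cnext≡next G {suc l} zero    = refl
cnext≡next G {suc l} (suc i) with cnext G i | cnext≡next G i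
... | zero  | eq = shift i eq
  where
  shift : ∀ i → zero ≡ next i → zero ≡ next (suc i)
  shift i eq with view i
  ... | ‵fromℕ     = sym (lastOr-fromℕ zero (λ j → suc (suc j)))
  ... | ‵inject₁ j with trans eq (lastOr-inject₁ zero suc j)
  ...   | ()
... | suc j | eq = shift i eq
  where
  shift : ∀ i → suc j ≡ next i → suc (suc j) ≡ next (suc i)
  shift i eq with view i
  ... | ‵fromℕ with trans eq (lastOr-fromℕ zero suc)
  ...   | ()
  shift i eq | ‵inject₁ j' = trans (cong suc (trans eq (lastOr-inject₁ zero suc j')))
                               (sym (lastOr-inject₁ zero (λ j → suc (suc j)) j'))

-- A cycle has at least three vertices, so it cannot run along an edge and straight back; this is
-- the only obstacle to going on inside a subdivided edge.
next²≢ : ∀ {n} (i : Fin (3 + n)) → next (next i) ≢ i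
next²≢ i eq with view i
next²≢ {n} _ eq | ‵fromℕ with trans (sym (cong next (lastOr-fromℕ zero suc))) eq
... | ()
next²≢ _ eq | ‵inject₁ j with trans (sym (cong next (lastOr-inject₁ zero suc j))) eq
... | eq' with view j
...   | ‵fromℕ with trans (sym (lastOr-fromℕ zero suc)) eq'
...     | ()
next²≢ _ eq | ‵inject₁ j | eq' | ‵inject₁ l = contradiction
  (trans (sym (trans (cong toℕ eq') (trans (toℕ-inject₁ _) (toℕ-inject₁ l)))) (cong toℕ (lastOr-inject₁ zero suc (suc l))))
  (m≢1+n+m (toℕ l))

rotation : ∀ {n} → Permutation (suc n) (suc n)
rotation = permutation next prev next-prev prev-next

sum-mono : ∀ {n} {f g : Fin n → ℕ} → (∀ i → f i ≤ g i) → sum f ≤ sum g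
sum-mono {zero}  f≤g = z≤n
sum-mono {suc n} f≤g = +-mono-≤ (f≤g zero) (sum-mono (f≤g ∘ suc))

sum-*ˡ : ∀ {n} c (f : Fin n → ℕ) → sum (λ i → c * f i) ≡ c * sum f
sum-*ˡ {zero}  c f = sym (*-zeroʳ c)
sum-*ˡ {suc n} c f = trans (cong (c * f zero +_) (sum-*ˡ c (f ∘ suc))) (sym (*-distribˡ-+ c _ _))

sum-const : ∀ n c → sum {n} (λ _ → c) ≡ n * c
sum-const zero    c = refl
sum-const (suc n) c = cong (c +_) (sum-const n c)

term≤sum : ∀ {n} (f : Fin n → ℕ) i → f i ≤ sum f
term≤sum f zero    = m≤m+n _ _
term≤sum f (suc i) = ≤-trans (term≤sum (f ∘ suc) i) (m≤n+m _ _)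

𝟙 : {A : Set} → Dec A → ℕ
𝟙 (yes _) = 1
𝟙 (no _)  = 0

𝟙≤1 : {A : Set} (a? : Dec A) → 𝟙 a? ≤ 1
𝟙≤1 (yes _) = ≤-refl
𝟙≤1 (no _)  = z≤n

𝟙-yes : {A : Set} (a? : Dec A) → A → 1 ≤ 𝟙 a?
𝟙-yes (yes _) a = ≤-refl
𝟙-yes (no ¬a) a = contradiction a ¬a

sum-𝟙-no : ∀ {n} {A : Fin n → Set} (a? : ∀ i → Dec (A i)) → (∀ i → ¬ A i) → sum (𝟙 ∘ a?) ≡ 0
sum-𝟙-no {zero}  a? ¬a = refl
sum-𝟙-no {suc n} a? ¬a with a? zero
... | yes a = contradiction a (¬a zero)
... | no _  = sum-𝟙-no (a? ∘ suc) (¬a ∘ suc)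

sum-𝟙-unique : ∀ {n} {A : Fin n → Set} (a? : ∀ i → Dec (A i)) →
  (∀ {i j} → A i → A j → i ≡ j) → (e? : Dec (∃ A)) → sum (𝟙 ∘ a?) ≤ 𝟙 e?
sum-𝟙-unique {n}     a? unique (no ¬e) = ≤-reflexive (sum-𝟙-no a? λ i a → ¬e (i , a))
sum-𝟙-unique {zero}  a? unique (yes _) = z≤n
sum-𝟙-unique {suc n} {A} a? unique (yes _) with a? zero
... | yes a = s≤s (≤-reflexive (sum-𝟙-no (a? ∘ suc) ¬a))
  where
  ¬a : ∀ i → ¬ A (suc i)
  ¬a i a' with unique a a'
  ... | ()
... | no _ = ≤-trans (sum-𝟙-unique (a? ∘ suc) (λ a a' → Fin.suc-injective (unique a a')) (any? (a? ∘ suc)))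
                     (𝟙≤1 (any? (a? ∘ suc)))

sum-gap : ∀ {n} b (f : Fin n → ℕ) → (∀ i → f i ≡ 0 ⊎ b ≤ f i) → sum f ≡ 0 ⊎ b ≤ sum f
sum-gap {zero}  b f gap = inj₁ refl
sum-gap {suc n} b f gap with gap zero | sum-gap b (f ∘ suc) (gap ∘ suc)
... | inj₂ p | _      = inj₂ (≤-trans p (m≤m+n _ _))
... | inj₁ _ | inj₂ q = inj₂ (≤-trans q (m≤n+m _ _))
... | inj₁ p | inj₁ q = inj₁ (cong₂ _+_ p q)

module Cycles (P : PlaneMap) (ι′ : PlaneMap.E P → ℕ)
  (graph : Graph) (code : Subdivision.W P ι′ → Vertex graph) (code-injective : ∀ {x y} → code x ≡ code y → x ≡ y)
  (adj⁻ : ∀ {x y} → T (Graph.adj graph x y) →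
    ∃[ d ] (code (Subdivision.endˢ P ι′ d) ≡ x × code (Subdivision.endˢ P ι′ (flip d)) ≡ y))
  where

  open PlaneMap P using (E)
  open Subdivision P ι′ hiding (rotate)

  edge : U × Bool → E
  edge ((x , _) , _) = x

  -- The last unit edge of an edge of P, seen in the direction of travel.
  final : U × Bool → ℕ
  final ((x , k)     , true)  = lastOr 1 (λ _ → 0) k
  final ((x , zero)  , false) = 1
  final ((x , suc _) , false) = 0

  -- The distance from the end at which the edge is entered to the start of the dart. It serves as a
  -- potential in `len≡total`.
  offset : U × Bool → ℕ
  offset ((x , k) , true)  = toℕ k
  offset ((x , k) , false) = ι x ∸ toℕ k

  -- The inner vertex at which the final unit edge begins. Runs through an edge are counted by
  -- visits to its tips, because a packing bounds visits to vertices only.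
  tip : E → Bool → Inner
  tip x true  = x , fromℕ _
  tip x false = x , zero

  final-flip-start : ∀ d → final (flip (start d)) ≡ 1
  final-flip-start (x , true)  = refl
  final-flip-start (x , false) = lastOr-fromℕ {n = ι x} 1 (λ _ → 0)

  offset-flip-start : ∀ d → suc (offset (flip (start d))) ≡ ℓ (edge (flip (start d)))
  offset-flip-start (x , true)  = refl
  offset-flip-start (x , false) = cong suc (toℕ-fromℕ (ι x))

  offset-start : ∀ d → offset (start d) ≡ 0
  offset-start (x , true)  = refl
  offset-start (x , false) = trans (cong (ι x ∸_) (toℕ-fromℕ (ι x))) (n∸n≡0 (ι x))

  leaves-base : ∀ d d' → endˢ d' ≡ endˢ (start d) → offset d' ≡ 0
  leaves-base d d' eq with dartView d'
  ... | ‵start c = offset-start c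
  ... | ‵forth p = contradiction (sym eq) (start≢inner d {d' = forth p} refl)
  ... | ‵back p  = contradiction (sym eq) (start≢inner d {d' = back p} (end-back p))

  leaves-inner : ∀ p d' → endˢ d' ≡ inj₂ p → d' ≡ forth p ⊎ d' ≡ back p
  leaves-inner p d' eq with dartView d'
  ... | ‵start c with trans (sym (end-start c)) eq
  ...   | ()
  leaves-inner p d' eq | ‵forth q with refl ← inner-injective {q} {p} eq = inj₁ refl
  leaves-inner p d' eq | ‵back q
    with refl ← inner-injective {q} {p} (trans (sym (end-back q)) eq) = inj₂ refl

  -- A cycle cannot turn round, so inside an edge of P it goes straight on.
  straight : ∀ c d' → endˢ d' ≡ endˢ c → endˢ (flip d') ≢ endˢ (flip c) →
    suc (offset (flip c)) ≡ final (flip c) * ℓ (edge (flip c)) + offset d'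
  straight c d' eq neq with dartView c
  ... | ‵start b = begin
    suc (offset (flip (start b)))             ≡⟨ offset-flip-start b ⟩
    ℓ x                                       ≡⟨ *-identityˡ (ℓ x) ⟨
    1 * ℓ x                                   ≡⟨ cong (_* ℓ x) (final-flip-start b) ⟨
    final (flip (start b)) * ℓ x              ≡⟨ +-identityʳ _ ⟨
    final (flip (start b)) * ℓ x + 0          ≡⟨ cong (final (flip (start b)) * ℓ x +_) (leaves-base b d' eq) ⟨
    final (flip (start b)) * ℓ x + offset d'  ∎
    where
    open ≡-Reasoning
    x = edge (flip (start b))
  ... | ‵forth p@(x , j) with leaves-inner p d' eq
  ...   | inj₁ refl = contradiction refl neq
  ...   | inj₂ refl = trans (sym (+-∸-assoc 1 (toℕ<n j))) (cong (ι x ∸_) (sym (toℕ-inject₁ j)))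
  straight c d' eq neq | ‵back p@(x , j) with leaves-inner p d' (trans eq (end-back p))
  ...   | inj₂ refl = contradiction refl neq
  ...   | inj₁ refl = trans (cong suc (toℕ-inject₁ j))
            (cong (λ z → z * ℓ x + suc (toℕ j)) (sym (lastOr-inject₁ 1 (λ _ → 0) j)))

  final≤ : ∀ d → final d ≡ 0 ⊎ final d ≡ 1 × ∃[ b ] endˢ d ≡ inj₂ (tip (edge d) b)
  final≤ ((x , zero)  , false) = inj₂ (refl , false , refl)
  final≤ ((x , suc _) , false) = inj₁ refl
  final≤ ((x , k)     , true)  with view k
  ... | ‵fromℕ     = inj₂ (lastOr-fromℕ {n = ι x} 1 (λ _ → 0) , true , refl)
  ... | ‵inject₁ j = inj₁ (lastOr-inject₁ 1 (λ _ → 0) j)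

  module _ (C : Cycle graph) where

    open Cycle C

    link : ∀ i → ∃[ d ] (code (endˢ d) ≡ vs i × code (endˢ (flip d)) ≡ vs (cnext graph i))
    link i = adj⁻ (edges i)

    dartAt : Fin len → U × Bool
    dartAt i = proj₁ (link i)

    vs-dartAt : ∀ i → code (endˢ (dartAt i)) ≡ vs i
    vs-dartAt i = proj₁ (proj₂ (link i))

    vs-flip-dartAt : ∀ i → code (endˢ (flip (dartAt i))) ≡ vs (next i)
    vs-flip-dartAt i = trans (proj₂ (proj₂ (link i))) (cong vs (cnext≡next graph i))

    step-straight : ∀ i → suc (offset (dartAt i)) ≡
      final (dartAt i) * ℓ (edge (dartAt i)) + offset (dartAt (next i))
    step-straight i = subst (λ d → suc (offset d) ≡ final d * ℓ (edge d) + offset (dartAt (next i)))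
      (flip-involutive (dartAt i))
      (straight (flip (dartAt i)) (dartAt (next i))
        (code-injective (trans (vs-dartAt (next i)) (sym (vs-flip-dartAt i)))) turn-back)
      where
      turn-back : endˢ (flip (dartAt (next i))) ≢ endˢ (flip (flip (dartAt i)))
      turn-back eq = next²≢ i (inj (begin
        vs (next (next i))                        ≡⟨ vs-flip-dartAt (next i) ⟨
        code (endˢ (flip (dartAt (next i))))      ≡⟨ cong code eq ⟩
        code (endˢ (flip (flip (dartAt i))))      ≡⟨ cong (code ∘ endˢ) (flip-involutive (dartAt i)) ⟩
        code (endˢ (dartAt i))                    ≡⟨ vs-dartAt i ⟩
        vs i                                      ∎))
        where open ≡-Reasoning

    -- The sum of w over the edges of P that the cycle runs through.
    total : (E → ℕ) → ℕ
    total w = sum λ i → final (dartAt i) * w (edge (dartAt i))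

    -- A unit step raises `offset` by one, except that completing an edge x drops it from `ℓ x` - 1
    -- to 0. Around the cycle the offsets cancel, and the number of steps equals the total length of
    -- the completed edges, wherever the cycle happens to start.
    len≡total : len ≡ total ℓ
    len≡total = +-cancelʳ-≡ (sum (offset ∘ dartAt)) len (total ℓ) (begin
      len + sum (offset ∘ dartAt)                   ≡⟨ cong (_+ sum (offset ∘ dartAt)) (trans (sum-const len 1) (*-identityʳ len)) ⟨
      sum {len} (λ _ → 1) + sum (offset ∘ dartAt)   ≡⟨ ∑-distrib-+ (λ _ → 1) (offset ∘ dartAt) ⟨
      sum (suc ∘ offset ∘ dartAt)                   ≡⟨ sum-cong-≗ step-straight ⟩
      sum (λ i → final (dartAt i) * ℓ (edge (dartAt i)) + offset (dartAt (next i)))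
        ≡⟨ ∑-distrib-+ (λ i → final (dartAt i) * ℓ (edge (dartAt i))) (offset ∘ dartAt ∘ next) ⟩
      total ℓ + sum (offset ∘ dartAt ∘ next)        ≡⟨ cong (total ℓ +_) (sum-permute (offset ∘ dartAt) rotation) ⟨
      total ℓ + sum (offset ∘ dartAt)               ∎)
      where open ≡-Reasoning

    total-cong : ∀ {w w'} → (∀ x → w x ≡ w' x) → total w ≡ total w'
    total-cong eq = sum-cong-≗ λ i → cong (final (dartAt i) *_) (eq (edge (dartAt i)))

    total-+ : ∀ w w' → total (λ x → w x + w' x) ≡ total w + total w'
    total-+ w w' = trans
      (sum-cong-≗ λ i → *-distribˡ-+ (final (dartAt i)) (w (edge (dartAt i))) (w' (edge (dartAt i))))
      (∑-distrib-+ (λ i → final (dartAt i) * w (edge (dartAt i))) (λ i → final (dartAt i) * w' (edge (dartAt i))))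

    total-* : ∀ c w → total (λ x → c * w x) ≡ c * total w
    total-* c w = trans
      (sum-cong-≗ λ i → swap (final (dartAt i)) c (w (edge (dartAt i))))
      (sum-*ˡ c (λ i → final (dartAt i) * w (edge (dartAt i))))
      where
      swap : ∀ a b c → a * (b * c) ≡ b * (a * c)
      swap = solve-∀

    -- Every term of `total ℓ` is 0 or the length of a whole edge, and the terms are not all 0
    -- because `len` is positive.
    len≥ : ∀ b → (∀ x → b ≤ ℓ x) → b ≤ len
    len≥ b b≤ with sum-gap b (λ i → final (dartAt i) * ℓ (edge (dartAt i))) (λ i → gap (dartAt i))
      where
      gap : ∀ d → final d * ℓ (edge d) ≡ 0 ⊎ b ≤ final d * ℓ (edge d)
      gap d with final d | final≤ d
      ... | _ | inj₁ refl       = inj₁ refl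
      ... | _ | inj₂ (refl , _) = inj₂ (≤-trans (b≤ (edge d)) (≤-reflexive (sym (*-identityˡ (ℓ (edge d))))))
    ... | inj₂ le = ≤-trans le (≤-reflexive (sym len≡total))
    ... | inj₁ eq = contradiction (trans len≡total eq) λ ()

    -- An edge of P that the cycle runs through is left through one of its two
    -- tips, and each tip is on the cycle at most once.
    total-marked : ∀ {r} (w : E → ℕ) (mark : Fin r → E) →
      (∀ x → w x ≡ 0 ⊎ w x ≡ 1 × ∃[ j ] mark j ≡ x) →
      total w ≤ sum λ j → 𝟙 (onCycle? graph (code (inj₂ (tip (mark j) true))) C)
                        + 𝟙 (onCycle? graph (code (inj₂ (tip (mark j) false))) C)
    total-marked {r} w mark marked = begin
      total w                                                     ≤⟨ sum-mono pointwise ⟩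
      sum (λ i → sum λ j → at i j true + at i j false)            ≡⟨ ∑-comm (λ i j → at i j true + at i j false) ⟩
      sum (λ j → sum λ i → at i j true + at i j false)
        ≡⟨ sum-cong-≗ (λ j → ∑-distrib-+ (λ i → at i j true) (λ i → at i j false)) ⟩
      sum (λ j → sum (λ i → at i j true) + sum (λ i → at i j false))
        ≤⟨ sum-mono (λ j → +-mono-≤ (visits j true) (visits j false)) ⟩
      sum (λ j → on j true + on j false)                          ∎
      where
      open ≤-Reasoning
      spot : Fin r → Bool → Vertex graph
      spot j b = code (inj₂ (tip (mark j) b))
      at : Fin len → Fin r → Bool → ℕ
      at i j b = 𝟙 (vs i Fin.≟ spot j b)
      on : Fin r → Bool → ℕ
      on j b = 𝟙 (onCycle? graph (spot j b) C)
      visits : ∀ j b → sum (λ i → at i j b) ≤ on j b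
      visits j b = sum-𝟙-unique (λ i → vs i Fin.≟ spot j b) (λ p q → inj (trans p (sym q)))
        (onCycle? graph (spot j b) C)
      at-tip : ∀ i j b → endˢ (dartAt i) ≡ inj₂ (tip (mark j) b) → 1 ≤ at i j true + at i j false
      at-tip i j b tipped = either b (𝟙-yes (vs i Fin.≟ spot j b) (trans (sym (vs-dartAt i)) (cong code tipped)))
        where
        either : ∀ b → 1 ≤ at i j b → 1 ≤ at i j true + at i j false
        either true  le = ≤-trans le (m≤m+n (at i j true) (at i j false))
        either false le = ≤-trans le (m≤n+m (at i j false) (at i j true))
      bound : ∀ f d n → f ≡ 0 ⊎ f ≡ 1 × ∃[ b ] endˢ d ≡ inj₂ (tip (edge d) b) →
        (∀ j b → endˢ d ≡ inj₂ (tip (mark j) b) → 1 ≤ n j) → f * w (edge d) ≤ sum n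
      bound _ d n (inj₁ refl) _ = z≤n
      bound _ d n (inj₂ (refl , b , tipped)) hit with w (edge d) | marked (edge d)
      ... | _ | inj₁ refl = z≤n
      ... | _ | inj₂ (refl , j , eq) =
              ≤-trans (hit j b (trans tipped (cong (λ x → inj₂ (tip x b)) (sym eq)))) (term≤sum n j)
      pointwise : ∀ i → final (dartAt i) * w (edge (dartAt i)) ≤ sum λ j → at i j true + at i j false
      pointwise i = bound (final (dartAt i)) (dartAt i) (λ j → at i j true + at i j false)
        (final≤ (dartAt i)) (at-tip i)

-- Cycles from closed walks

-- A walk that runs through the listed edges, all of them forward.
data Walk {V E : Set} (end : E × Bool → V) : V → V → List E → Set where
  []  : ∀ {v} → Walk end v v []
  _∷_ : ∀ x {v xs} → Walk end (end (x , false)) v xs → Walk end (end (x , true)) v (x ∷ xs)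

module _ {V E : Set} {end : E × Bool → V} where

  infixr 5 _++ʷ_
  _++ʷ_ : ∀ {u v w xs ys} → Walk end u v xs → Walk end v w ys → Walk end u w (xs ++ ys)
  []      ++ʷ q = q
  (x ∷ p) ++ʷ q = x ∷ (p ++ʷ q)

  walk-tabulate : ∀ {n} (f : Fin (suc n) → V) (l : Fin (suc n) → List E) {z} →
    (∀ j → Walk end (f (inject₁ j)) (f (suc j)) (l (inject₁ j))) →
    Walk end (f (fromℕ n)) z (l (fromℕ n)) → Walk end (f zero) z (concat (tabulate l))
  walk-tabulate {zero}  f l steps final = final ++ʷ []
  walk-tabulate {suc n} f l steps final = steps zero ++ʷ walk-tabulate (f ∘ suc) (l ∘ suc) (steps ∘ suc) final

  walk-empty : ∀ {u v} → Walk end u v [] → u ≡ v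
  walk-empty [] = refl

  walk-first : ∀ {u v x xs} → Walk end u v (x ∷ xs) → end (x , true) ≡ u
  walk-first (x ∷ p) = refl

  walk-step : ∀ {u v x xs} → Walk end u v (x ∷ xs) →
    ∀ j → end (lookup (x ∷ xs) (inject₁ j) , false) ≡ end (lookup (x ∷ xs) (suc j) , true)
  walk-step {xs = y ∷ xs} (x ∷ p) zero    = sym (walk-first p)
  walk-step {xs = y ∷ xs} (x ∷ p) (suc j) = walk-step p j

  walk-last : ∀ {u v x xs} → Walk end u v (x ∷ xs) → end (lookup (x ∷ xs) (fromℕ _) , false) ≡ v
  walk-last {xs = []}     (x ∷ p) = walk-empty p
  walk-last {xs = y ∷ xs} (x ∷ p) = walk-last p

  walk-next : ∀ {v x xs} → Walk end v v (x ∷ xs) →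
    ∀ i → end (lookup (x ∷ xs) i , false) ≡ end (lookup (x ∷ xs) (next i) , true)
  walk-next {x = x} {xs} p i with view i
  ... | ‵fromℕ     = trans (walk-last p) (trans (sym (walk-first p))
                       (cong (λ i → end (lookup (x ∷ xs) i , true)) (sym (lastOr-fromℕ zero suc))))
  ... | ‵inject₁ j = trans (walk-step p j)
                       (cong (λ i → end (lookup (x ∷ xs) i , true)) (sym (lastOr-inject₁ zero suc j)))

lookup-map-injective : {A B : Set} (f : A → B) (xs : List A) → Unique (map f xs) →
  ∀ {i j} → f (lookup xs i) ≡ f (lookup xs j) → i ≡ j
lookup-map-injective f (x ∷ xs) (p ∷ u) {zero}  {zero}  eq = refl
lookup-map-injective f (x ∷ xs) (p ∷ u) {suc i} {suc j} eq = cong suc (lookup-map-injective f xs u eq)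
lookup-map-injective f (x ∷ xs) (p ∷ u) {zero}  {suc j} eq = contradiction eq (All.lookup (All.map⁻ p) (∈-lookup j))
lookup-map-injective f (x ∷ xs) (p ∷ u) {suc i} {zero}  eq = contradiction (sym eq) (All.lookup (All.map⁻ p) (∈-lookup i))

weight : {A : Set} → (A → ℕ) → List A → ℕ
weight w xs = List.sum (map w xs)

weight-++ : {A : Set} (w : A → ℕ) (xs ys : List A) → weight w (xs ++ ys) ≡ weight w xs + weight w ys
weight-++ w []       ys = refl
weight-++ w (x ∷ xs) ys = trans (cong (w x +_) (weight-++ w xs ys)) (sym (+-assoc (w x) _ _))

weight-concat-tabulate : {A : Set} (w : A → ℕ) {n : ℕ} (l : Fin n → List A) →
  weight w (concat (tabulate l)) ≡ sum (weight w ∘ l)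
weight-concat-tabulate w {zero}  l = refl
weight-concat-tabulate w {suc n} l =
  trans (weight-++ w (l zero) _) (cong (weight w (l zero) +_) (weight-concat-tabulate w (l ∘ suc)))

concat-tabulate-singleton : {A : Set} {n : ℕ} (f : Fin n → A) → concat (tabulate λ i → f i ∷ []) ≡ tabulate f
concat-tabulate-singleton {n = zero}  f = refl
concat-tabulate-singleton {n = suc n} f = cong (f zero ∷_) (concat-tabulate-singleton (f ∘ suc))

module Routes (P : PlaneMap) (ι′ : PlaneMap.E P → ℕ)
  (graph : Graph) (code : Subdivision.W P ι′ → Vertex graph) (code-injective : ∀ {x y} → code x ≡ code y → x ≡ y)
  (adj⁺ : ∀ {x y} → ∃[ d ] (code (Subdivision.endˢ P ι′ d) ≡ x × code (Subdivision.endˢ P ι′ (flip d)) ≡ y) →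
    T (Graph.adj graph x y))
  where

  open PlaneMap P using (V; E; end)
  open Subdivision P ι′ hiding (rotate)

  units : E → List U
  units x = tabulate (x ,_)

  walk-edge : ∀ x → Walk endˢ (inj₁ (end (x , true))) (inj₁ (end (x , false))) (units x)
  walk-edge x = subst (Walk endˢ _ _) (concat-tabulate-singleton (x ,_))
    (walk-tabulate {n = ι x} (λ k → lo (x , k)) (λ k → (x , k) ∷ [])
      (λ j → subst (λ w → Walk endˢ (lo (x , inject₁ j)) w ((x , inject₁ j) ∷ [])) (end-back (x , j)) ((x , inject₁ j) ∷ []))
      (subst (λ w → Walk endˢ (lo (x , fromℕ _)) w ((x , fromℕ _) ∷ [])) (end-start (x , false)) ((x , fromℕ _) ∷ [])))

  walk-subdivide : ∀ {u v xs} → Walk end u v xs → Walk endˢ (inj₁ u) (inj₁ v) (concatMap units xs)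
  walk-subdivide []      = []
  walk-subdivide (x ∷ p) = walk-edge x ++ʷ walk-subdivide p

  length-units : ∀ xs → length (concatMap units xs) ≡ weight ℓ xs
  length-units []       = refl
  length-units (x ∷ xs) = trans (length-++ (units x)) (cong₂ _+_ (length-tabulate {A = U} {n = ℓ x} (x ,_)) (length-units xs))

  lo-injective : ∀ x {k k'} → lo (x , k) ≡ lo (x , k') → k ≡ k'
  lo-injective x {zero}  {zero}  eq   = refl
  lo-injective x {suc j} {suc _} refl = refl

  lo-≢ : ∀ {x x'} → end (x , true) ≢ end (x' , true) → ∀ k k' → lo (x , k) ≢ lo (x' , k')
  lo-≢ neq zero    zero    eq   = neq (base-injective eq)
    where
    base-injective : ∀ {v v'} → _≡_ {A = W} (inj₁ v) (inj₁ v') → v ≡ v'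
    base-injective refl = refl
  lo-≢ neq (suc j) (suc _) refl = neq refl

  -- An inner vertex belongs to one edge only, so the subdivided route can repeat a vertex only
  -- where the route itself repeats a source.
  unique-units : ∀ xs → Unique (map (λ x → end (x , true)) xs) → Unique (map lo (concatMap units xs))
  unique-units xs unique = subst Unique (sym (map-concatMap lo units xs))
    (Unique.concat⁺ (All.map⁺ (All.tabulate λ {x} _ → subst Unique (sym (map-tabulate (x ,_) lo))
                        (Unique.tabulate⁺ (lo-injective x))))
      (AllPairs.map⁺ (AllPairs.map disjoint (AllPairs.map⁻ unique))))
    where
    disjoint : ∀ {x x'} → end (x , true) ≢ end (x' , true) → ∀ {w} → ¬ (w ∈ map lo (units x) × w ∈ map lo (units x'))
    disjoint {x} {x'} neq (p , q) with ∈-map⁻ lo p | ∈-map⁻ lo q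
    ... | u , u∈ , refl | u' , u'∈ , eq with ∈-tabulate⁻ {f = x ,_} u∈ | ∈-tabulate⁻ {f = x' ,_} u'∈
    ...   | k , refl | k' , refl = lo-≢ neq k k' eq

  edge∈ : ∀ xs {u} → u ∈ concatMap units xs → proj₁ u ∈ xs
  edge∈ xs u∈ with ∈-concat⁻′ (map units xs) u∈
  ... | us , u∈us , us∈ with ∈-map⁻ units us∈
  ...   | x , x∈ , refl with ∈-tabulate⁻ {f = x ,_} u∈us
  ...     | k , refl = x∈

  close : ∀ {w} (us : List U) → 3 ≤ length us → Walk endˢ w w us → Unique (map lo us) →
    ∃[ C ] (Cycle.len {graph} C ≡ length us × ∀ i → ∃[ u ] (Cycle.vs C i ≡ code (lo u) × u ∈ us))
  close []            ()
  close (_ ∷ [])      (s≤s ())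
  close (_ ∷ _ ∷ [])  (s≤s (s≤s ()))
  close us@(a ∷ b ∷ c ∷ rest) _ p unique = C , refl , λ i → lookup us i , refl , ∈-lookup i
    where
    C : Cycle graph
    C = record
      { m     = length rest
      ; vs    = λ i → code (lo (lookup us i))
      ; inj   = λ eq → lookup-map-injective lo us unique (code-injective eq)
      ; edges = λ i → adj⁺ ((lookup us i , true) , refl , cong code
                  (trans (walk-next p i) (cong (lo ∘ lookup us) (sym (cnext≡next graph i)))))
      }

  route-cycle : ∀ {v xs} → Walk end v v xs → Unique (map (λ x → end (x , true)) xs) → 3 ≤ weight ℓ xs →
    ∃[ C ] (Cycle.len {graph} C ≡ weight ℓ xs × ∀ i → ∃[ u ] (Cycle.vs C i ≡ code (lo u) × proj₁ u ∈ xs))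
  route-cycle {xs = xs} p unique long
    with close (concatMap units xs) (≤-trans long (≤-reflexive (sym (length-units xs))))
               (walk-subdivide p) (unique-units xs unique)
  ... | C , len≡ , on = C , trans len≡ (length-units xs) ,
          λ i → let (u , eq , u∈) = on i in u , eq , edge∈ xs u∈

-- Arithmetic of the edge lengths

1≤d≤n⇒d∣n! : ∀ {d n} → 1 ≤ d → d ≤ n → d ∣ n !
1≤d≤n⇒d∣n! {suc d} _ d≤n = ∣-trans (m∣m*n (d !)) (m≤n⇒m!∣n! d≤n)

1≤n⇒n≤n! : ∀ {n} → 1 ≤ n → n ≤ n !
1≤n⇒n≤n! {n} 1≤n = ∣⇒≤ {{n !≢0}} (1≤d≤n⇒d∣n! 1≤n ≤-refl)

primeFactor : ∀ n → 2 ≤ n → ∃[ p ] (Prime p × p ∣ n)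
primeFactor (suc zero) (s≤s ())
primeFactor (suc (suc n)) _ with factorise (suc (suc n))
... | record { factors = [] ; isFactorisation = () }
primeFactor (suc (suc n)) _ | record { factors = p ∷ ps ; isFactorisation = eq ; factorsPrime = pr ∷ _ } =
  p , pr , subst (p ∣_) (sym eq) (m∣m*n _)

-- Euclid: a prime factor of n! + 1 that is less than n would also divide n!, hence 1.
prime≥ : ∀ n → ∃[ p ] (Prime p × n ≤ p)
prime≥ n with primeFactor (suc (n !)) (s≤s (1≤n! n))
... | p , pr , p∣ = p , pr , ≮⇒≥ λ p<n → contradiction
        (subst Prime (∣1⇒≡1 (∣m+n∣m⇒∣n (subst (p ∣_) (+-comm 1 (n !)) p∣)
          (1≤d≤n⇒d∣n! (>-nonZero⁻¹ p {{prime⇒nonZero pr}}) (<⇒≤ p<n)))) pr)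
        ¬prime[1]

-- Edge lengths for which a cycle running through a edges of length
-- P - q γ (mod M), b < q edges of length γ and otherwise edges of length M
-- has composite length whenever a ≤ c.
record Scales (q c B : ℕ) : Set where
  field
    M γ P   : ℕ
    prime   : Prime P
    3≤M     : 3 ≤ M
    M≤γ     : M ≤ γ
    γ≤2M    : γ ≤ 2 * M
    B*M≤P   : B * M ≤ P
    ¬prime  : ∀ len a b x y → M ≤ len → a ≤ c → b < q →
              len + (a * (q * γ) + M * x) ≡ a * P + (b * γ + M * y) → ¬ Prime len

-- With z = (2 + c)! let γ = z r, where r ≡ - P modulo all 1 + d z for
-- 1 ≤ d ≤ q.  Then z divides the length if a = 0, a divides it if 2 ≤ a ≤ c,
-- and since P - d γ ≡ P (1 + d z), it is divisible by 1 + (q - b) z if a = 1.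
scales : ∀ q c B → 1 ≤ q → Scales q c B
scales q c B 1≤q = record
  { M = M ; γ = γ ; P = P ; prime = proj₁ (proj₂ big)
  ; 3≤M = ≤-trans (s≤s 2≤z) z<M
  ; M≤γ = *-monoʳ-≤ z M'≤r
  ; γ≤2M = ≤-trans (*-monoʳ-≤ z (m∸n≤m (2 * M') (P % M'))) (≤-reflexive (double z M'))
  ; B*M≤P = proj₂ (proj₂ big)
  ; ¬prime = ¬prime
  }
  where
  z M' M : ℕ
  -- All a with 1 ≤ a ≤ c divide `z`, and all 1 + d z with d ≤ q divide `M'`. The 2 makes `z` itself
  -- an admissible divisor when c is small.
  z  = (2 + c) !
  M' = (1 + q * z) !
  M  = z * M'
  instance
    M'≢0 : NonZero M'
    M'≢0 = (1 + q * z) !≢0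
  big = prime≥ (B * M)
  P r γ : ℕ
  P = proj₁ big
  -- This is - P modulo `M'`. Starting from 2 M' puts `r` between M' and 2 M', and so `γ` between M
  -- and 2 M.
  r = 2 * M' ∸ P % M'
  γ = z * r

  double : ∀ a b → a * (2 * b) ≡ 2 * (a * b)
  double = solve-∀

  2≤z : 2 ≤ z
  2≤z = ≤-trans (s≤s (s≤s z≤n)) (1≤n⇒n≤n! {2 + c} (s≤s z≤n))

  c≤z : c ≤ z
  c≤z = ≤-trans (m≤n+m c 2) (1≤n⇒n≤n! {2 + c} (s≤s z≤n))

  1+qz≤M' : 1 + q * z ≤ M'
  1+qz≤M' = 1≤n⇒n≤n! {1 + q * z} (s≤s z≤n)

  2≤M' : 2 ≤ M'
  2≤M' = ≤-trans (s≤s (≤-trans (s≤s z≤n) (*-mono-≤ 1≤q 2≤z))) 1+qz≤M'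

  z<M : z < M
  z<M = ≤-trans (≤-trans (s≤s (m≤m+n z 0)) (+-monoˡ-≤ (z + 0) (≤-trans (s≤s z≤n) 2≤z)))
          (≤-trans (≤-reflexive (*-comm 2 z)) (*-monoʳ-≤ z 2≤M'))

  M'<M : M' < M
  M'<M = ≤-trans (≤-trans (s≤s (m≤m+n M' 0)) (+-monoˡ-≤ (M' + 0) (≤-trans (s≤s z≤n) 2≤M'))) (*-monoˡ-≤ M' 2≤z)

  M'≤r : M' ≤ r
  M'≤r = ≤-trans (≤-reflexive (sym (trans (cong (_∸ M') (cong (M' +_) (+-identityʳ M'))) (m+n∸n≡m M' M'))))
           (∸-monoʳ-≤ (2 * M') (m%n≤n P M'))

  M'∣r+P : M' ∣ r + P
  M'∣r+P = divides (2 + P / M') (begin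
    r + P                                       ≡⟨ cong (r +_) (m≡m%n+[m/n]*n P M') ⟩
    r + (P % M' + P / M' * M')                  ≡⟨ +-assoc r (P % M') _ ⟨
    r + P % M' + P / M' * M'                    ≡⟨ cong (_+ P / M' * M') (m∸n+n≡m (≤-trans (m%n≤n P M') (m≤m+n M' _))) ⟩
    2 * M' + P / M' * M'                        ≡⟨ *-distribʳ-+ M' 2 (P / M') ⟨
    (2 + P / M') * M'                           ∎)
    where open ≡-Reasoning

  M'∣M : M' ∣ M
  M'∣M = n∣m*n z

  divisor : ∀ {len} d → 2 ≤ d → d < M → M ≤ len → d ∣ len → ¬ Prime len
  divisor d 2≤d d<M M≤len d∣ = composite⇒¬prime (composite (<-≤-trans d<M M≤len) d∣)
    where instance _ = n>1⇒nonTrivial 2≤d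

  ¬prime : ∀ len a b x y → M ≤ len → a ≤ c → b < q →
    len + (a * (q * γ) + M * x) ≡ a * P + (b * γ + M * y) → ¬ Prime len
  ¬prime len zero b x y M≤len _ _ eq = divisor z 2≤z z<M M≤len
    (∣m+n∣m⇒∣n (subst (z ∣_) (trans (sym eq) (+-comm len (M * x)))
        (∣m∣n⇒∣m+n (∣n⇒∣m*n b (m∣m*n r)) (∣m⇒∣m*n y (m∣m*n M'))))
      (∣m⇒∣m*n x (m∣m*n M')))
  ¬prime len (suc zero) b x y M≤len _ b<q eq = divisor D 2≤D D<M M≤len D∣len
    where
    d D : ℕ
    d = q ∸ b
    D = 1 + d * z
    1≤d : 1 ≤ d
    1≤d = m<n⇒0<n∸m b<q
    2≤D : 2 ≤ D
    2≤D = s≤s (≤-trans (s≤s z≤n) (*-mono-≤ 1≤d 2≤z))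
    D≤ : D ≤ 1 + q * z
    D≤ = s≤s (*-monoˡ-≤ z (m∸n≤m q b))
    D<M : D < M
    D<M = <-≤-trans (s≤s (≤-trans D≤ 1+qz≤M')) M'<M
    D∣M' : D ∣ M'
    D∣M' = 1≤d≤n⇒d∣n! (s≤s z≤n) D≤
    D∣M : D ∣ M
    D∣M = ∣-trans D∣M' M'∣M
    regroup : ∀ l d b z r p mx → (l + (1 * ((d + b) * (z * r)) + mx)) + d * z * p ≡ (d * z * (r + p) + mx + b * (z * r)) + l
    regroup = solve-∀
    expand : ∀ d b z r p my → (1 * p + (b * (z * r) + my)) + d * z * p ≡ (my + p * (1 + d * z)) + b * (z * r)
    expand = solve-∀
    regroup' : ∀ a b c → a + b + c ≡ a + c + b
    regroup' = solve-∀
    -- After b γ is cancelled, d γ = d z r is left next to `len`. Adding d z P on both sides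
    -- completes it to d z (r + P), a multiple of `D`, and turns P into P D.
    balance : (d * z * (r + P) + M * x) + len ≡ M * y + P * D
    balance = +-cancelʳ-≡ (b * γ) _ _ (begin
      d * z * (r + P) + M * x + len + b * γ                  ≡⟨ regroup' (d * z * (r + P) + M * x) len (b * γ) ⟩
      d * z * (r + P) + M * x + b * γ + len                  ≡⟨ regroup len d b z r P (M * x) ⟨
      len + (1 * ((d + b) * γ) + M * x) + d * z * P          ≡⟨ cong (λ n → len + (1 * (n * γ) + M * x) + d * z * P) (m∸n+n≡m (<⇒≤ b<q)) ⟩
      len + (1 * (q * γ) + M * x) + d * z * P                ≡⟨ cong (_+ d * z * P) eq ⟩
      1 * P + (b * γ + M * y) + d * z * P                    ≡⟨ expand d b z r P (M * y) ⟩
      M * y + P * D + b * γ                                  ∎)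
      where open ≡-Reasoning
    D∣len : D ∣ len
    D∣len = ∣m+n∣m⇒∣n (subst (D ∣_) (sym balance) (∣m∣n⇒∣m+n (∣m⇒∣m*n y D∣M) (n∣m*n P)))
      (∣m∣n⇒∣m+n (∣n⇒∣m*n (d * z) (∣-trans D∣M' M'∣r+P)) (∣m⇒∣m*n x D∣M))
  ¬prime len a@(suc (suc a')) b x y M≤len a≤c _ eq = divisor a (s≤s (s≤s z≤n)) (≤-<-trans (≤-trans a≤c c≤z) z<M) M≤len
    (∣m+n∣m⇒∣n (subst (a ∣_) (trans (sym eq) (+-comm len _))
        (∣m∣n⇒∣m+n (m∣m*n P) (∣m∣n⇒∣m+n (∣n⇒∣m*n b (∣m⇒∣m*n r a∣z)) (∣m⇒∣m*n y (∣m⇒∣m*n M' a∣z)))))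
      (∣m∣n⇒∣m+n (m∣m*n (q * γ)) (∣m⇒∣m*n x (∣m⇒∣m*n M' a∣z))))
    where
    a∣z : a ∣ z
    a∣z = 1≤d≤n⇒d∣n! (s≤s z≤n) (≤-trans a≤c (m≤n+m c 2))

-- Counting

𝟙-mono : {A B : Set} (a? : Dec A) (b? : Dec B) → (A → B) → 𝟙 a? ≤ 𝟙 b?
𝟙-mono (no _)  b? f = z≤n
𝟙-mono (yes a) b? f = 𝟙-yes b? (f a)

𝟙-¬ : {A : Set} (a? : Dec A) → 𝟙 a? + 𝟙 (¬? a?) ≡ 1
𝟙-¬ (yes _) = refl
𝟙-¬ (no _)  = refl

sum-𝟙-any : ∀ {n} {A : Fin n → Set} (a? : ∀ i → Dec (A i)) (e? : Dec (∃ A)) → 𝟙 e? ≤ sum (𝟙 ∘ a?)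
sum-𝟙-any a? (no _)        = z≤n
sum-𝟙-any a? (yes (i , a)) = ≤-trans (𝟙-yes (a? i) a) (term≤sum (𝟙 ∘ a?) i)

sum-𝟙-witness : ∀ {n} {A : Fin n → Set} (a? : ∀ i → Dec (A i)) → 1 ≤ sum (𝟙 ∘ a?) → ∃ A
sum-𝟙-witness {suc n} a? le with a? zero
... | yes a = zero , a
... | no _  = let (i , a) = sum-𝟙-witness (a? ∘ suc) le in suc i , a

length-filter-tabulate : ∀ {n} {A : Set} {P : A → Set} (p? : ∀ x → Dec (P x)) (f : Fin n → A) →
  length (filter p? (tabulate f)) ≡ sum (λ i → 𝟙 (p? (f i)))
length-filter-tabulate {zero}  p? f = refl
length-filter-tabulate {suc n} p? f with p? (f zero)
... | yes _ = cong suc (length-filter-tabulate p? (f ∘ suc))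
... | no _  = length-filter-tabulate p? (f ∘ suc)

sum-𝟙-∈ : ∀ {n} (X : Subset n) → sum (λ x → 𝟙 (x ∈? X)) ≤ ∣ X ∣
sum-𝟙-∈ []            = z≤n
sum-𝟙-∈ (true ∷ X)  = s≤s (≤-trans (sum-mono λ x → 𝟙-mono (suc x ∈? (true ∷ X)) (x ∈? X) drop-there) (sum-𝟙-∈ X))
sum-𝟙-∈ (false ∷ X) = ≤-trans (sum-mono λ x → 𝟙-mono (suc x ∈? (false ∷ X)) (x ∈? X) drop-there) (sum-𝟙-∈ X)

module _ {n r} (X : Subset n) (g : Fin n → Fin r) where

  Hit : Fin r → Set
  Hit j = ∃[ x ] (x ∈ˢ X × g x ≡ j)

  hit? : ∀ j → Dec (Hit j)
  hit? j = any? λ x → (x ∈? X) ×-dec (g x Fin.≟ j)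

  -- The map g sorts the vertices into classes, later circles or ovals. A member of X lies in one
  -- class only, so counting pairs of a class and a member of X inside it gives the bound.
  hits≤ : sum (𝟙 ∘ hit?) ≤ ∣ X ∣
  hits≤ = begin
    sum (𝟙 ∘ hit?)                                        ≤⟨ sum-mono (λ j → sum-𝟙-any (λ x → at? x j) (hit? j)) ⟩
    sum (λ j → sum λ x → 𝟙 (at? x j))                     ≡⟨ ∑-comm (λ j x → 𝟙 (at? x j)) ⟩
    sum (λ x → sum λ j → 𝟙 (at? x j))                     ≤⟨ sum-mono (λ x → ≤-trans (once x) (𝟙-mono (any? (at? x)) (x ∈? X) (proj₁ ∘ proj₂))) ⟩
    sum (λ x → 𝟙 (x ∈? X))                                ≤⟨ sum-𝟙-∈ X ⟩
    ∣ X ∣                                                 ∎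
    where
    open ≤-Reasoning
    at? : ∀ x j → Dec (x ∈ˢ X × g x ≡ j)
    at? x j = (x ∈? X) ×-dec (g x Fin.≟ j)
    once : ∀ x → sum (𝟙 ∘ at? x) ≤ 𝟙 (any? (at? x))
    once x = sum-𝟙-unique (at? x) (λ (_ , p) (_ , q) → trans (sym p) q) (any? (at? x))

  misses≥ : r ∸ ∣ X ∣ ≤ sum (𝟙 ∘ ¬? ∘ hit?)
  misses≥ = ≤-trans (∸-monoʳ-≤ r hits≤) (m≤n+o⇒m∸n≤o r (sum (𝟙 ∘ hit?)) (≤-reflexive (begin
    r                                             ≡⟨ *-identityʳ r ⟨
    r * 1                                         ≡⟨ sum-const r 1 ⟨
    sum {r} (λ _ → 1)                             ≡⟨ sum-cong-≗ (λ j → 𝟙-¬ (hit? j)) ⟨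
    sum (λ j → 𝟙 (hit? j) + 𝟙 (¬? (hit? j)))      ≡⟨ ∑-distrib-+ (𝟙 ∘ hit?) (𝟙 ∘ ¬? ∘ hit?) ⟩
    sum (𝟙 ∘ hit?) + sum (𝟙 ∘ ¬? ∘ hit?)          ∎)))
    where open ≡-Reasoning

bit : Bool → ℕ
bit b = if b then 1 else 0

choose : ∀ {n} {A : Fin n → Set} (a? : ∀ i → Dec (A i)) q → q ≤ sum (𝟙 ∘ a?) →
  ∃[ S ] ((∀ i → S i ≡ true → A i) × sum (bit ∘ S) ≡ q)
choose {zero}  a? zero    _  = (λ ()) , (λ ()) , refl
choose {suc n} {A} a? q le with a? zero
... | no _ = let (S , S⊆A , eq) = choose (a? ∘ suc) q le in
        (λ { zero → false ; (suc i) → S i }) , (λ { zero () ; (suc i) → S⊆A i }) , eq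
choose {suc n} {A} a? zero le | yes a = let (S , S⊆A , eq) = choose (a? ∘ suc) zero z≤n in
        (λ { zero → false ; (suc i) → S i }) , (λ { zero () ; (suc i) → S⊆A i }) , eq
choose {suc n} {A} a? (suc q) (s≤s le) | yes a = let (S , S⊆A , eq) = choose (a? ∘ suc) q le in
        (λ { zero → true ; (suc i) → S i }) , (λ { zero _ → a ; (suc i) → S⊆A i }) , cong suc eq

-- The value b is taken n minus `sum (bit ∘ S)` times; moving that term to the left avoids the
-- subtraction.
sum-if : ∀ {n} (S : Fin n → Bool) a b →
  sum (λ i → if S i then a else b) + sum (bit ∘ S) * b ≡ sum (bit ∘ S) * a + n * b
sum-if {zero}  S a b = refl
sum-if {suc n} S a b with S zero
... | true  = trans (lemma₁ a (sum λ i → if S (suc i) then a else b) (sum (bit ∘ S ∘ suc)) b)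
                (trans (cong (a + b +_) (sum-if (S ∘ suc) a b)) (lemma₂ a b (sum (bit ∘ S ∘ suc)) (n * b)))
  where
  lemma₁ : ∀ a x c b → a + x + (1 + c) * b ≡ a + b + (x + c * b)
  lemma₁ = solve-∀
  lemma₂ : ∀ a b c d → a + b + (c * a + d) ≡ (1 + c) * a + (b + d)
  lemma₂ = solve-∀
... | false = trans (+-assoc b _ _) (trans (cong (b +_) (sum-if (S ∘ suc) a b)) (swap b (sum (bit ∘ S ∘ suc) * a) (n * b)))
  where
  swap : ∀ a b c → a + (b + c) ≡ b + (a + c)
  swap = solve-∀

-- The planar graphs

weight-cong : {A : Set} {w w' : A → ℕ} → (∀ x → w x ≡ w' x) → ∀ xs → weight w xs ≡ weight w' xs
weight-cong eq []       = refl
weight-cong eq (x ∷ xs) = cong₂ _+_ (eq x) (weight-cong eq xs)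

weight-map : {A B : Set} (w : B → ℕ) (f : A → B) → ∀ xs → weight w (map f xs) ≡ weight (w ∘ f) xs
weight-map w f []       = refl
weight-map w f (x ∷ xs) = cong (w (f x) +_) (weight-map w f xs)

module Detours (m′ k : ℕ) (M γ : ℕ) where

  open Ovals m′ k

  arcLength : Side → ℕ
  arcLength (L y) = lastOr γ (λ _ → M) y
  arcLength (R y) = M

  level : Side → Fin h
  level (L y) = y
  level (R y) = y

  source : E → V
  source x = end (x , true)

  -- The way from L y over the top to R y, given by sides so that one list serves all ovals. `extra`
  -- counts its arcs other than the top one. `above` keeps the vertices distinct when the detour is
  -- prolonged from below, and `end∉` when an edge starting in R y is appended.
  record Detour (y : Fin h) : Set where
    field
      sides   : List Side
      walk    : ∀ i → Walk end (i , L y) (i , R y) (map (λ s → arc i s) sides)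
      unique  : Unique sides
      above   : All (λ s → toℕ y ≤ toℕ (level s)) sides
      end∉    : All (_≢ R y) sides
      extra   : ℕ
      weighs  : weight arcLength sides ≡ γ + extra * M
      extra≤  : extra + 2 * toℕ y ≤ 2 * k

  abstract
    detour : ∀ y → Detour y
    detour = >-weakInduction Detour top below
      where
      top : Detour (fromℕ k)
      top = record
        { sides  = L (fromℕ k) ∷ []
        ; walk   = λ i → arc i (L (fromℕ k)) ∷ subst (λ s → Walk end (i , s) (i , R (fromℕ k)) []) (sym succ-top) []
        ; unique = [] ∷ []
        ; above  = ≤-refl ∷ []
        ; end∉   = (λ ()) ∷ []
        ; extra  = 0
        ; weighs = cong (_+ 0) (lastOr-fromℕ γ (λ (_ : Fin k) → M))
        ; extra≤ = ≤-reflexive (cong (2 *_) (toℕ-fromℕ k))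
        }
      below : ∀ j → Detour (suc j) → Detour (inject₁ j)
      below j D = record
        { sides  = L (inject₁ j) ∷ (sides ++ R (suc j) ∷ [])
        ; walk   = λ i → arc i (L (inject₁ j)) ∷
            subst₂ (λ s xs → Walk end (i , s) (i , R (inject₁ j)) xs) (sym (succ-L j))
              (sym (map-++ (λ s → arc i s) sides (R (suc j) ∷ [])))
              (walk i ++ʷ (arc i (R (suc j)) ∷ []))
        ; unique = All.++⁺ (All.map L≢ above) ((λ ()) ∷ [])
            ∷ Unique.++⁺ unique ([] ∷ []) λ { (p , here refl) → All.lookup end∉ p refl }
        ; above  = ≤-refl ∷ All.++⁺ (All.map (≤-trans j≤) above) (j≤ ∷ [])
        ; end∉   = (λ ()) ∷ All.++⁺ (All.map R≢ above) (R≢ {R (suc j)} ≤-refl ∷ [])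
        ; extra  = 2 + extra
        ; weighs = trans (cong₂ _+_ (lastOr-inject₁ γ (λ _ → M) j)
              (trans (weight-++ arcLength sides _) (cong (_+ (M + 0)) weighs)))
              (count M γ extra)
        ; extra≤ = ≤-trans (≤-reflexive (trans (cong (λ n → 2 + extra + 2 * n) (toℕ-inject₁ j))
                     (shift extra (toℕ j)))) extra≤
        }
        where
        open Detour D
        j≤ : toℕ (inject₁ j) ≤ suc (toℕ j)
        j≤ = ≤-trans (≤-reflexive (toℕ-inject₁ j)) (n≤1+n _)
        R≢ : ∀ {s} → suc (toℕ j) ≤ toℕ (level s) → s ≢ R (inject₁ j)
        R≢ le refl = 1+n≰n (≤-trans le (≤-reflexive (toℕ-inject₁ j)))
        L≢ : ∀ {s} → suc (toℕ j) ≤ toℕ (level s) → L (inject₁ j) ≢ s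
        L≢ le refl = 1+n≰n (≤-trans le (≤-reflexive (toℕ-inject₁ j)))
        count : ∀ M γ e → M + (γ + e * M + (M + 0)) ≡ γ + (2 + e) * M
        count = solve-∀
        shift : ∀ e j → 2 + e + 2 * j ≡ e + 2 * suc j
        shift = solve-∀

-- The number suc m′ of ovals is 2 q, the number of circles is q.
module Construction (s : ℕ) where

  q m′ : ℕ
  q  = suc s
  m′ = s + q

  open Ovals m′ s

  -- In units of M: q detours of at most 2 + 2 s each (as γ ≤ 2 M), q chords, m′ ordinary gaps, and
  -- one more unit so that the closing edge is still at least M long.
  B : ℕ
  B = q * (2 + 2 * s) + q + m′ + 1

  module Lengths (S : Scales q (h * 2) B) where

    open Scales S
    open Detours m′ s M γ

    detourLength : Fin h → ℕ
    detourLength y = weight arcLength (Detour.sides (detour y))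

    -- The gaps after the last oval get the lengths that make the routes below
    -- have length P.
    closing : Fin h → ℕ
    closing y = P ∸ (q * detourLength y + q * M + m′ * M)

    edgeLength : E → ℕ
    edgeLength (arc i s)   = arcLength s
    edgeLength (chord i y) = M
    edgeLength (gap i y)   = lastOr (closing y) (λ _ → M) i

    ι′ : E → ℕ
    ι′ x = edgeLength x ∸ 3

    others≤ : ∀ y → M + (q * detourLength y + q * M + m′ * M) ≤ P
    others≤ y = ≤-trans bound B*M≤P
      where
      open ≤-Reasoning
      extra≤2s : Detour.extra (detour y) ≤ 2 * s
      extra≤2s = ≤-trans (m≤m+n _ _) (Detour.extra≤ (detour y))
      collect : ∀ q m M s → M + (q * (2 * M + 2 * s * M) + q * M + m * M) ≡ (q * (2 + 2 * s) + q + m + 1) * M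
      collect = solve-∀
      bound : M + (q * detourLength y + q * M + m′ * M) ≤ B * M
      bound = begin
        M + (q * detourLength y + q * M + m′ * M)
          ≡⟨ cong (λ n → M + (q * n + q * M + m′ * M)) (Detour.weighs (detour y)) ⟩
        M + (q * (γ + Detour.extra (detour y) * M) + q * M + m′ * M)
          ≤⟨ +-monoʳ-≤ M (+-monoˡ-≤ (m′ * M) (+-monoˡ-≤ (q * M)
               (*-monoʳ-≤ q (+-mono-≤ γ≤2M (*-monoˡ-≤ M extra≤2s))))) ⟩
        M + (q * (2 * M + 2 * s * M) + q * M + m′ * M)
          ≡⟨ collect q m′ M s ⟩
        B * M ∎

    closing-sum : ∀ y → closing y + (q * detourLength y + q * M + m′ * M) ≡ P
    closing-sum y = m∸n+n≡m (≤-trans (m≤n+m _ M) (others≤ y))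

    M≤closing : ∀ y → M ≤ closing y
    M≤closing y = m+n≤o⇒m≤o∸n M (others≤ y)

    M≤edgeLength : ∀ x → M ≤ edgeLength x
    M≤edgeLength (arc i (L y)) with view y
    ... | ‵fromℕ     = ≤-trans M≤γ (≤-reflexive (sym (lastOr-fromℕ γ (λ (_ : Fin s) → M))))
    ... | ‵inject₁ j = ≤-reflexive (sym (lastOr-inject₁ γ (λ _ → M) j))
    M≤edgeLength (arc i (R y)) = ≤-refl
    M≤edgeLength (chord i y)   = ≤-refl
    M≤edgeLength (gap i y) with view i
    ... | ‵fromℕ     = ≤-trans (M≤closing y) (≤-reflexive (sym (lastOr-fromℕ (closing y) (λ (_ : Fin m′) → M))))
    ... | ‵inject₁ j = ≤-reflexive (sym (lastOr-inject₁ (closing y) (λ _ → M) j))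

    open Subdivision ovals ι′ using (W; endˢ; ℓ; lo)

    ℓ≡edgeLength : ∀ x → ℓ x ≡ edgeLength x
    ℓ≡edgeLength x = m+[n∸m]≡n (≤-trans 3≤M (M≤edgeLength x))

    closes summit : E → ℕ
    closes (gap i y) = lastOr 1 (λ _ → 0) i
    closes _         = 0
    summit (arc i (L y)) = lastOr 1 (λ _ → 0) y
    summit _             = 0

    -- Together with `closes` and `summit` these write every edge length in terms of P, γ and M. The
    -- deficit stands on the side of the length because a closing edge has length P - q γ - M
    -- `deficit`.
    deficit ordinary : E → ℕ
    deficit (gap i y) = lastOr (q * Detour.extra (detour y) + q + m′) (λ _ → 0) i
    deficit _         = 0
    ordinary (arc i (L y)) = lastOr 0 (λ _ → 1) y
    ordinary (arc i (R y)) = 1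
    ordinary (chord i y)   = 1
    ordinary (gap i y)     = lastOr 0 (λ _ → 1) i

    ordinaryBalance : M + (q * γ * 0 + M * 0) ≡ P * 0 + (γ * 0 + M * 1)
    ordinaryBalance = ring γ (q * γ) M P
      where
      ring : ∀ g a M P → M + (a * 0 + M * 0) ≡ P * 0 + (g * 0 + M * 1)
      ring = solve-∀

    balance : ∀ x → edgeLength x + (q * γ * closes x + M * deficit x)
                  ≡ P * closes x + (γ * summit x + M * ordinary x)
    balance (arc i (L y)) with view y
    ... | ‵fromℕ     rewrite lastOr-fromℕ γ (λ (_ : Fin s) → M) | lastOr-fromℕ 1 (λ (_ : Fin s) → 0)
                           | lastOr-fromℕ 0 (λ (_ : Fin s) → 1) = ring γ (q * γ) M P
      where
      ring : ∀ g a M P → g + (a * 0 + M * 0) ≡ P * 0 + (g * 1 + M * 0)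
      ring = solve-∀
    ... | ‵inject₁ j rewrite lastOr-inject₁ γ (λ (_ : Fin s) → M) j | lastOr-inject₁ 1 (λ (_ : Fin s) → 0) j
                           | lastOr-inject₁ 0 (λ (_ : Fin s) → 1) j = ordinaryBalance
    balance (arc i (R y)) = ordinaryBalance
    balance (chord i y) = ordinaryBalance
    balance (gap i y) with view i
    ... | ‵inject₁ j rewrite lastOr-inject₁ (closing y) (λ (_ : Fin m′) → M) j | lastOr-inject₁ 1 (λ (_ : Fin m′) → 0) j
                           | lastOr-inject₁ 0 (λ (_ : Fin m′) → 1) j
                           | lastOr-inject₁ (q * Detour.extra (detour y) + q + m′) (λ (_ : Fin m′) → 0) j = ordinaryBalance
    ... | ‵fromℕ     rewrite lastOr-fromℕ (closing y) (λ (_ : Fin m′) → M) | lastOr-fromℕ 1 (λ (_ : Fin m′) → 0)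
                           | lastOr-fromℕ 0 (λ (_ : Fin m′) → 1)
                           | lastOr-fromℕ (q * Detour.extra (detour y) + q + m′) (λ (_ : Fin m′) → 0) = begin
      closing y + (q * γ * 1 + M * (q * e + q + m′))             ≡⟨ cong (closing y +_) (regroup q γ M e m′) ⟩
      closing y + (q * (γ + e * M) + q * M + m′ * M)             ≡⟨ cong (λ n → closing y + (q * n + q * M + m′ * M)) (Detour.weighs (detour y)) ⟨
      closing y + (q * detourLength y + q * M + m′ * M)          ≡⟨ closing-sum y ⟩
      P                                                          ≡⟨ ring γ M P ⟩
      P * 1 + (γ * 0 + M * 0)                                    ∎
      where
      open ≡-Reasoning
      e = Detour.extra (detour y)
      regroup : ∀ q g M e m → q * g * 1 + M * (q * e + q + m) ≡ q * (g + e * M) + q * M + m * M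
      regroup = solve-∀
      ring : ∀ g M P → P ≡ P * 1 + (g * 0 + M * 0)
      ring = solve-∀

    row : E → Fin h
    row (arc i s)   = zero
    row (chord i y) = y
    row (gap i y)   = y

    oval : E → Fin m
    oval (arc i s)   = i
    oval (chord i y) = i
    oval (gap i y)   = i

    -- On the interior of an arc rowOf has a junk value, which only makes the
    -- search for a row that avoids a set of vertices more restrictive.
    rowOf : W → Fin h
    rowOf (inj₁ (i , s)) = level s
    rowOf (inj₂ (x , _)) = row x

    ovalOf : W → Fin m
    ovalOf (inj₁ (i , s)) = i
    ovalOf (inj₂ (x , _)) = oval x

    -- Routes of prime length

    module Routing (y : Fin h) (chosen : Fin m → Bool) where

      open Detour (detour y)

      around : Bool → Fin m → List E
      around true  i = map (λ s → arc i s) sides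
      around false i = chord i y ∷ []

      segment : Fin m → List E
      segment i = around (chosen i) i ++ gap i y ∷ []

      route : List E
      route = concat (tabulate segment)

      segment-walk : ∀ i → Walk end (i , L y) (next i , L y) (segment i)
      segment-walk i = around-walk (chosen i) ++ʷ (gap i y ∷ [])
        where
        around-walk : ∀ b → Walk end (i , L y) (i , R y) (around b i)
        around-walk true  = walk i
        around-walk false = chord i y ∷ []

      route-walk : Walk end (zero , L y) (zero , L y) route
      route-walk = walk-tabulate (λ i → i , L y) segment
        (λ j → subst (λ i → Walk end (inject₁ j , L y) (i , L y) (segment (inject₁ j)))
          (lastOr-inject₁ zero suc j) (segment-walk (inject₁ j)))
        (subst (λ i → Walk end (fromℕ m′ , L y) (i , L y) (segment (fromℕ m′)))
          (lastOr-fromℕ zero suc) (segment-walk (fromℕ m′)))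

      stops : Bool → List Side
      stops true  = sides ++ R y ∷ []
      stops false = L y ∷ R y ∷ []

      stops-unique : ∀ b → Unique (stops b)
      stops-unique true  = Unique.++⁺ unique ([] ∷ []) λ { (p , here refl) → All.lookup end∉ p refl }
      stops-unique false = ((λ ()) ∷ []) ∷ [] ∷ []

      segment-sources : ∀ i → map source (segment i) ≡ map (i ,_) (stops (chosen i))
      segment-sources i = sources (chosen i)
        where
        sources : ∀ b → map source (around b i ++ gap i y ∷ []) ≡ map (i ,_) (stops b)
        sources true  = trans (map-++ source (map (λ s → arc i s) sides) _)
          (trans (cong (_++ (i , R y) ∷ []) (sym (map-∘ sides))) (sym (map-++ (i ,_) sides _)))
        sources false = refl

      route-sources : map source route ≡ concat (tabulate λ i → map (i ,_) (stops (chosen i)))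
      route-sources = begin
        map source (concat (tabulate segment))                  ≡⟨ concat-map (tabulate segment) ⟨
        concat (map (map source) (tabulate segment))            ≡⟨ cong concat (map-tabulate segment (map source)) ⟩
        concat (tabulate (map source ∘ segment))                ≡⟨ cong concat (tabulate-cong segment-sources) ⟩
        concat (tabulate λ i → map (i ,_) (stops (chosen i)))   ∎
        where
        open ≡-Reasoning

      route-unique : Unique (map source route)
      route-unique = subst Unique (sym route-sources)
        (Unique.concat⁺ (All.tabulate⁺ λ i → Unique.map⁺ {f = i ,_} (cong proj₂) (stops-unique (chosen i)))
          (AllPairs.tabulate⁺ disjoint))
        where
        disjoint : ∀ {i j} → i ≢ j → ∀ {v} →
          ¬ (v ∈ map (i ,_) (stops (chosen i)) × v ∈ map (j ,_) (stops (chosen j)))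
        disjoint i≢j (p , q) with ∈-map⁻ _ p | ∈-map⁻ _ q
        ... | _ , _ , refl | _ , _ , eq = i≢j (cong proj₁ eq)

      gapLength : Fin m → ℕ
      gapLength = lastOr {n = m′} (closing y) (λ _ → M)

      segment-weight : ∀ i → weight edgeLength (segment i)
        ≡ (if chosen i then detourLength y else M) + gapLength i
      segment-weight i = around-weight (chosen i)
        where
        around-weight : ∀ b → weight edgeLength (around b i ++ gap i y ∷ [])
          ≡ (if b then detourLength y else M) + gapLength i
        around-weight true  = trans (weight-++ edgeLength (map (λ s → arc i s) sides) _)
          (cong₂ _+_ (weight-map edgeLength (λ s → arc i s) sides) (+-identityʳ _))
        around-weight false = cong (M +_) (+-identityʳ _)

      -- The m - q ovals that are not chosen number q again. So besides its closing edge the route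
      -- has q detours, q chords and m′ gaps of length M, exactly what `closing` subtracts from P.
      route-weight : sum (bit ∘ chosen) ≡ q → weight ℓ route ≡ P
      route-weight chosen≡q = begin
        weight ℓ route                                  ≡⟨ weight-cong ℓ≡edgeLength route ⟩
        weight edgeLength route                         ≡⟨ weight-concat-tabulate edgeLength segment ⟩
        sum (weight edgeLength ∘ segment)               ≡⟨ sum-cong-≗ segment-weight ⟩
        sum (λ i → pick i + gapLength i)  ≡⟨ ∑-distrib-+ pick gapLength ⟩
        sum pick + sum gapLength   ≡⟨ cong₂ _+_ picks gaps ⟩
        q * detourLength y + q * M + (m′ * M + closing y)  ≡⟨ regroup (q * detourLength y + q * M) (m′ * M) (closing y) ⟩
        closing y + (q * detourLength y + q * M + m′ * M)  ≡⟨ closing-sum y ⟩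
        P                                               ∎
        where
        open ≡-Reasoning
        pick : Fin m → ℕ
        pick i = if chosen i then detourLength y else M
        regroup : ∀ a b c → a + (b + c) ≡ c + (a + b)
        regroup = solve-∀
        two : ∀ q a M → q * a + (q + q) * M ≡ q * a + q * M + q * M
        two = solve-∀
        picks : sum pick ≡ q * detourLength y + q * M
        picks = +-cancelʳ-≡ (q * M) _ _ (begin
          sum pick + q * M                             ≡⟨ cong (λ n → sum pick + n * M) chosen≡q ⟨
          sum pick + sum (bit ∘ chosen) * M            ≡⟨ sum-if chosen (detourLength y) M ⟩
          sum (bit ∘ chosen) * detourLength y + m * M  ≡⟨ cong (λ n → n * detourLength y + m * M) chosen≡q ⟩
          q * detourLength y + (q + q) * M             ≡⟨ two q (detourLength y) M ⟩
          q * detourLength y + q * M + q * M           ∎)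
        gaps : sum gapLength ≡ m′ * M + closing y
        gaps = trans (sum-init-last gapLength)
          (cong₂ _+_ (trans (sum-cong-≗ (lastOr-inject₁ (closing y) (λ (_ : Fin m′) → M))) (sum-const m′ M))
                     (lastOr-fromℕ (closing y) (λ (_ : Fin m′) → M)))

      -- This is how the route can avoid X: where it leaves circle y it stays on chosen ovals, so
      -- one free circle and q free ovals are enough.
      segment-edge : ∀ i {x} → x ∈ segment i → ∀ k →
        rowOf (lo (x , k)) ≡ y ⊎ chosen (ovalOf (lo (x , k))) ≡ true
      segment-edge i {x} x∈ k = [ on-around (chosen i) refl , on-gap k ]′ (∈-++⁻ (around (chosen i) i) x∈)
        where
        on-gap : ∀ k → x ∈ gap i y ∷ [] → rowOf (lo (x , k)) ≡ y ⊎ chosen (ovalOf (lo (x , k))) ≡ true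
        on-gap zero    (here refl) = inj₁ refl
        on-gap (suc k) (here refl) = inj₁ refl
        on-arc : ∀ s k → ovalOf (lo (arc i s , k)) ≡ i
        on-arc s zero    = refl
        on-arc s (suc k) = refl
        on-chord : ∀ k → rowOf (lo (chord i y , k)) ≡ y
        on-chord zero    = refl
        on-chord (suc k) = refl
        on-around : ∀ b → chosen i ≡ b → x ∈ around b i →
          rowOf (lo (x , k)) ≡ y ⊎ chosen (ovalOf (lo (x , k))) ≡ true
        on-around true eq x∈ with ∈-map⁻ (λ s → arc i s) x∈
        ... | s , _ , refl = inj₂ (trans (cong chosen (on-arc s k)) eq)
        on-around false eq (here refl) = inj₁ (on-chord k)

      route-edge : ∀ {x} → x ∈ route → ∀ k →
        rowOf (lo (x , k)) ≡ y ⊎ chosen (ovalOf (lo (x , k))) ≡ true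
      route-edge x∈ with ∈-concat⁻′ (tabulate segment) x∈
      ... | xs , x∈xs , xs∈ with ∈-tabulate⁻ {f = segment} xs∈
      ...   | i , refl = segment-edge i x∈xs

    -- Large packings and small hitting sets are impossible

    module Realised (graph : Graph) (code : W → Vertex graph) (decode : Vertex graph → W)
      (decode-code : ∀ w → decode (code w) ≡ w)
      (adj⁺ : ∀ {x y} → ∃[ d ] (code (endˢ d) ≡ x × code (endˢ (flip d)) ≡ y) → T (Graph.adj graph x y))
      (adj⁻ : ∀ {x y} → T (Graph.adj graph x y) → ∃[ d ] (code (endˢ d) ≡ x × code (endˢ (flip d)) ≡ y))
      where

      code-injective : ∀ {x y} → code x ≡ code y → x ≡ y
      code-injective eq = trans (sym (decode-code _)) (trans (cong decode eq) (decode-code _))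

      open Cycles ovals ι′ graph code code-injective adj⁻
      open Routes ovals ι′ graph code code-injective adj⁺ using (route-cycle)

      summitTip : Fin m → Bool → Vertex graph
      summitTip i b = code (inj₂ (tip (arc i (L (fromℕ s))) b))

      on : Vertex graph → Cycle graph → ℕ
      on v C = 𝟙 (onCycle? graph v C)

      closes-marked : ∀ x → closes x ≡ 0 ⊎ closes x ≡ 1 × ∃[ y ] gap (fromℕ m′) y ≡ x
      closes-marked (arc i s)   = inj₁ refl
      closes-marked (chord i y) = inj₁ refl
      closes-marked (gap i y) with view i
      ... | ‵fromℕ     = inj₂ (lastOr-fromℕ 1 (λ (_ : Fin m′) → 0) , y , refl)
      ... | ‵inject₁ j = inj₁ (lastOr-inject₁ 1 (λ (_ : Fin m′) → 0) j)

      summit-marked : ∀ x → summit x ≡ 0 ⊎ summit x ≡ 1 × ∃[ i ] arc i (L (fromℕ s)) ≡ x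
      summit-marked (arc i (R y)) = inj₁ refl
      summit-marked (chord i y)   = inj₁ refl
      summit-marked (gap i y)     = inj₁ refl
      summit-marked (arc i (L y)) with view y
      ... | ‵fromℕ     = inj₂ (lastOr-fromℕ 1 (λ (_ : Fin s) → 0) , i , refl)
      ... | ‵inject₁ j = inj₁ (lastOr-inject₁ 1 (λ (_ : Fin s) → 0) j)

      -- `balance`, summed over the edges that the cycle runs through, is the equation that `¬prime`
      -- expects, with a and b the numbers of closing edges and of top arcs used.
      total-balance : ∀ C → Cycle.len C + (total C closes * (q * γ) + M * total C deficit)
                          ≡ total C closes * P + (total C summit * γ + M * total C ordinary)
      total-balance C = begin
        Cycle.len C + (total C closes * (q * γ) + M * total C deficit)
          ≡⟨ cong₂ (λ a b → a + (b + M * total C deficit)) (len≡total C) (*-comm (total C closes) (q * γ)) ⟩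
        total C ℓ + (q * γ * total C closes + M * total C deficit)
          ≡⟨ linear ℓ (q * γ) closes M deficit ⟨
        total C (λ x → ℓ x + (q * γ * closes x + M * deficit x))
          ≡⟨ total-cong C (λ x → trans (cong (_+ (q * γ * closes x + M * deficit x)) (ℓ≡edgeLength x)) (balance x)) ⟩
        total C (λ x → P * closes x + (γ * summit x + M * ordinary x))
          ≡⟨ linear (λ x → P * closes x) γ summit M ordinary ⟩
        total C (λ x → P * closes x) + (γ * total C summit + M * total C ordinary)
          ≡⟨ cong₂ (λ a b → a + (b + M * total C ordinary))
               (trans (total-* C P closes) (*-comm P (total C closes))) (*-comm γ (total C summit)) ⟩
        total C closes * P + (total C summit * γ + M * total C ordinary) ∎
        where
        open ≡-Reasoning
        linear : ∀ w a w₁ b w₂ → total C (λ x → w x + (a * w₁ x + b * w₂ x))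
                               ≡ total C w + (a * total C w₁ + b * total C w₂)
        linear w a w₁ b w₂ = trans (total-+ C w (λ x → a * w₁ x + b * w₂ x))
          (cong (total C w +_) (trans (total-+ C (λ x → a * w₁ x) (λ x → b * w₂ x))
            (cong₂ _+_ (total-* C a w₁) (total-* C b w₂))))

      -- With fewer than q top arcs the length is composite by `¬prime`. The visits to tips, which
      -- are at least as many as the runs through top arcs, put this in terms of vertices.
      summits≥ : (C : PrimeCycle graph) →
        q ≤ sum (λ i → on (summitTip i true) (proj₁ C) + on (summitTip i false) (proj₁ C))
      summits≥ (C , len-prime) = ≤-trans (≮⇒≥ λ few → ¬prime (Cycle.len C) (total C closes) (total C summit)
          (total C deficit) (total C ordinary)
          (len≥ C M λ x → ≤-trans (M≤edgeLength x) (≤-reflexive (sym (ℓ≡edgeLength x))))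
          closes≤ few (total-balance C) len-prime)
        (total-marked C summit (λ i → arc i (L (fromℕ s))) summit-marked)
        where
        -- Each of the h closing edges has two tips, and a cycle visits each tip at most once. This
        -- is the origin of the parameter c = 2 h of `Scales`.
        closes≤ : total C closes ≤ h * 2
        closes≤ = ≤-trans (total-marked C closes (λ y → gap (fromℕ m′) y) closes-marked)
          (≤-trans (sum-mono λ y → +-mono-≤ (𝟙≤1 (onCycle? graph (code (inj₂ (tip (gap (fromℕ m′) y) true))) C))
                                            (𝟙≤1 (onCycle? graph (code (inj₂ (tip (gap (fromℕ m′) y) false))) C)))
            (≤-reflexive (sum-const h 2)))

      -- Double counting of visits to the tips of top arcs: each of the 4 t + 1 cycles makes at
      -- least q of them, but 2 q arcs with two tips each admit at most 4 t q. The factor q cancels,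
      -- which keeps the bound independent of s.
      no-packing : ∀ t → ¬ FractionalPacking graph t (suc (4 * t))
      no-packing t (Cs , light) = 1+n≰n {4 * t * q} (≤-trans (m≤n+m _ s) (begin
        s + suc (4 * t * q)                               ≡⟨ +-suc s (4 * t * q) ⟩
        suc (4 * t) * q                                   ≡⟨ sum-const (suc (4 * t)) q ⟨
        sum {suc (4 * t)} (λ _ → q)                       ≤⟨ sum-mono (λ j → summits≥ (Cs j)) ⟩
        sum (λ j → sum λ i → at i true j + at i false j)  ≡⟨ ∑-comm (λ j i → at i true j + at i false j) ⟩
        sum (λ i → sum λ j → at i true j + at i false j)  ≡⟨ sum-cong-≗ (λ i → ∑-distrib-+ (at i true) (at i false)) ⟩
        sum (λ i → sum (at i true) + sum (at i false))    ≤⟨ sum-mono (λ i → +-mono-≤ (load i true) (load i false)) ⟩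
        sum {m} (λ _ → t + t)                             ≡⟨ sum-const m (t + t) ⟩
        m * (t + t)                                       ≡⟨ four q t ⟩
        4 * t * q                                         ∎))
        where
        open ≤-Reasoning
        at : Fin m → Bool → Fin (suc (4 * t)) → ℕ
        at i b j = on (summitTip i b) (proj₁ (Cs j))
        load : ∀ i b → sum (at i b) ≤ t
        load i b = ≤-trans (≤-reflexive (sym (length-filter-tabulate
          (λ j → onCycle? graph (summitTip i b) (proj₁ (Cs j))) (λ j → j)))) (light (summitTip i b))
        four : ∀ q t → (q + q) * (t + t) ≡ 4 * t * q
        four = solve-∀

      route-prime : ∀ y chosen → sum (bit ∘ chosen) ≡ q → ∃[ C ] (Prime (Cycle.len {graph} C) ×
        ∀ i → ∃[ w ] (Cycle.vs C i ≡ code w × (rowOf w ≡ y ⊎ chosen (ovalOf w) ≡ true)))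
      route-prime y chosen chosen≡q = C , subst Prime (sym (trans len≡ weighs)) prime ,
          λ i → let ((x , k) , eq , x∈) = places i in lo (x , k) , eq , route-edge x∈ k
        where
        open Routing y chosen
        weighs : weight ℓ route ≡ P
        weighs = route-weight chosen≡q
        3≤P : 3 ≤ P
        3≤P = ≤-trans 3≤M (≤-trans (m≤m+n M _) (others≤ y))
        cycle = route-cycle route-walk route-unique (subst (3 ≤_) (sym weighs) 3≤P)
        C = proj₁ cycle
        len≡ = proj₁ (proj₂ cycle)
        places = proj₂ (proj₂ cycle)

      missed-hitting-set : ∀ X y chosen → ¬ Hit X (rowOf ∘ decode) y →
        (∀ i → chosen i ≡ true → ¬ Hit X (ovalOf ∘ decode) i) → sum (bit ∘ chosen) ≡ q → ¬ HittingSet graph X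
      missed-hitting-set X y chosen freeRow freeOvals chosen≡q hits = meet (route-prime y chosen chosen≡q)
        where
        decoded : ∀ {v w} → v ≡ code w → decode v ≡ w
        decoded {w = w} eq = trans (cong decode eq) (decode-code w)
        avoids : ∀ {v w} → v ≡ code w → rowOf w ≡ y ⊎ chosen (ovalOf w) ≡ true → ¬ v ∈ˢ X
        avoids eq (inj₁ r) v∈ = freeRow (_ , v∈ , trans (cong rowOf (decoded eq)) r)
        avoids eq (inj₂ o) v∈ = freeOvals _ o (_ , v∈ , cong ovalOf (decoded eq))
        meet : ∃[ C ] (Prime (Cycle.len {graph} C) ×
          ∀ i → ∃[ w ] (Cycle.vs C i ≡ code w × (rowOf w ≡ y ⊎ chosen (ovalOf w) ≡ true))) → ⊥
        meet (C , len-prime , places) = let (i , v∈) = hits (C , len-prime) ; (_ , eq , located) = places i in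
          avoids eq located v∈

      -- Pigeonhole with q = s + 1: X leaves at least q - s = 1 of the q rows and at least 2 q - s ≥
      -- q of the ovals untouched.
      no-hitting-set : ∀ X → ∣ X ∣ ≤ s → ¬ HittingSet graph X
      no-hitting-set X X≤s =
        let (y , freeRow) = sum-𝟙-witness (λ y → ¬? (hit? X (rowOf ∘ decode) y))
              (≤-trans (m+n≤o⇒m≤o∸n 1 (s≤s X≤s)) (misses≥ X (rowOf ∘ decode)))
            (chosen , freeOvals , chosen≡q) = choose (λ i → ¬? (hit? X (ovalOf ∘ decode) i)) q
              (≤-trans (m+n≤o⇒m≤o∸n q (+-monoʳ-≤ q (≤-trans X≤s (n≤1+n s)))) (misses≥ X (ovalOf ∘ decode)))
        in missed-hitting-set X y chosen freeRow freeOvals chosen≡q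

theorem1p2 : ∀ (t : ℕ) → 0 < t →
    ¬ (Σ (ℕ → ℕ) λ f →
    ∀ (k : ℕ) (G : Graph) → Planar G →
    FractionalPacking G t k
    ⊎ (∃[ X ] (∣ X ∣ ≤ f k × HittingSet G X)))
theorem1p2 t _ (f , erdősPósa) = [ no-packing t , (λ (X , X≤ , hits) → no-hitting-set X X≤ hits) ]′
    (erdősPósa (suc (4 * t)) graph planar)
  where
  -- The family size 4 t + 1 depends on t alone; the value of `f` there is the number of deleted
  -- vertices that the graph has to withstand.
  s = f (suc (4 * t))
  open Construction s
  S = scales q (Ovals.h m′ s * 2) B (s≤s z≤n)
  open Lengths S using (ι′; module Realised)
  open Subdivision (Ovals.ovals m′ s) ι′ using (subdivide; simple)
  open Realisation subdivide simple using (graph; code; decode; decode-code; adj⁺; adj⁻; planar)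
  open Realised graph code decode decode-code adj⁺ adj⁻
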